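{- For any instance of the online load balancing problem in the hypergraph model, and any solution $(x_{ij})_{j\in J,i\in\mathcal S_j}$ obtained by the algorithm Greedy, there exists a feasible solution of the dual semidefinite program (SDP-LB) in the hypergraph model with objective value at least $$\frac{1}{3+2\sqrt2}\sum_{e\in M}L_e(x)^2 .$$ Consequently the competitive ratio of Greedy is at most $3+2\sqrt2$, i.e. $\sum_{e\in M}L_e(x)^2\le(3+2\sqrt2)\,\mathrm{OPT}$.
   Context: Hypergraph model: a finite set of machines $M$ is given; jobs $J=\{1,\dots,n\}$ arrive in this order. When $j$ arrives it reveals a nonempty collection $\mathcal S_j\subseteq 2^M$ of subsets (hyperedges) of machines it can be assigned to, and weights $w_{ej}\ge0$ for the machines $e\in M$. A solution is $x_{ij}\in\{0,1\}$ for $i\in\mathcal S_j$ with $\sum_{i\in\mathcal S_j}x_{ij}=1$ for every $j$ ($x_{ij}=1$ means $j$ is assigned to the hyperedge $i$). Loads: $L_e^{(j)}(x)=\sum_{k\le j}w_{ek}\sum_{i\in\mathcal S_k:\,e\in i}x_{ik}$ and $L_e(x)=L_e^{(n)}(x)$. The cost is $\sum_{e\in M}L_e(x)^2$ and $\mathrm{OPT}$ is its minimum over all solutions. Greedy: when $j$ arrives, set $x_{ij}=1$ for a hyperedge $i\in\mathcal S_j$ which gives the minimal increase in the global objective $\sum_{e\in M}L_e^2$ (ties broken arbitrarily). (SDP-LB), hypergraph model: variables $y_j\in\mathbb R$ ($j\in J$), $\nu\in\mathbb R^M$, $v_{ij}\in\mathbb R^M$ ($j\in J,i\in\mathcal S_j$);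 maximize $\sum_{j\in J}y_j-\frac12\|\nu\|^2$ subject to - $y_j\le\sum_{e\in i}w_{ej}^2-\frac12\|v_{ij}\|^2+\langle\nu,v_{ij}\rangle$ for all $j\in J$, $i\in\mathcal S_j$; - $\langle v_{ij},v_{i'k}\rangle\le2\sum_{e\in i\cap i'}w_{ej}w_{ek}$ for all $(i,j)\ne(i',k)$ with $j,k\in J$, $i\in\mathcal S_j$, $i'\in\mathcal S_k$. -}

module Defs where

open import Algebra.Bundles using (RawMonoid)
import Algebra.Definitions.RawMonoid as RawMonoidDefs
open import Data.Bool.Base using (Bool; true; false; if_then_else_)
open import Data.Fin.Base using (Fin; toℕ)
open import Data.Fin.Subset using (Subset; _∩_)
open import Data.Fin.Subset.Properties using (_∈?_)
open import Data.Integer.Base as ℤ using (+_; +[1+_])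
import Data.Integer.Properties as ℤₚ
open import Data.Nat.Base as ℕ using (ℕ; zero; suc)
import Data.Nat.Properties as ℕₚ
open import Data.Product.Base using (Σ; ∃; ∃-syntax; _×_; _,_; proj₁; proj₂)
open import Data.Rational.Base as ℚ using (ℚ; 0ℚ; 1ℚ; ½; mkℚ; ∣_∣)
import Data.Rational.Properties as ℚₚ
open import Data.Rational.Solver using (module +-*-Solver)
import Data.Rational.Unnormalised.Base as ℚᵘ
import Data.Rational.Unnormalised.Properties as ℚᵘₚ
open import Data.Sum.Base using (_⊎_; inj₁; inj₂)
open import Data.Vec.Functional using (Vector)
open import Function.Definitions using (Injective)
open import Level using (0ℓ)
open import Relation.Binary.PropositionalEquality
open import Relation.Nullary.Decidable using (does; yes; no)
open import Relation.Nullary.Negation using (contradiction)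

open +-*-Solver using (solve; _:+_; _:-_; _:*_; :-_; _:=_; con)

-- Cauchy sequences of rationals, with _≃_ as equality of reals.

record ℝ : Set where
  constructor mkℝ
  field
    seq    : ℕ → ℚ
    cauchy : ∀ ε → 0ℚ ℚ.< ε → ∃[ N ] ∀ m n → N ℕ.≤ m → N ℕ.≤ n →
             ∣ seq m ℚ.- seq n ∣ ℚ.< ε

open ℝ public

infix 4 _≃_ _≤_

_≃_ : ℝ → ℝ → Set
x ≃ y = ∀ ε → 0ℚ ℚ.< ε → ∃[ N ] ∀ n → N ℕ.≤ n →
        ∣ seq x n ℚ.- seq y n ∣ ℚ.< ε

_≤_ : ℝ → ℝ → Set
x ≤ y = ∀ ε → 0ℚ ℚ.< ε → ∃[ N ] ∀ n → N ℕ.≤ n → seq x n ℚ.≤ seq y n ℚ.+ ε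

-- Strict positivity carries an eventual rational lower bound, which is what
-- makes the reciprocal computable.
Pos : ℝ → Set
Pos x = ∃[ δ ] 0ℚ ℚ.< δ × ∃[ N ] ∀ n → N ℕ.≤ n → δ ℚ.≤ seq x n

≤-respˡ : ∀ {p q r} → p ≡ q → p ℚ.≤ r → q ℚ.≤ r
≤-respˡ refl p≤r = p≤r

0<1 : 0ℚ ℚ.< 1ℚ
0<1 = ℚₚ.positive⁻¹ 1ℚ

p<p+q : ∀ p {q} → 0ℚ ℚ.< q → p ℚ.< p ℚ.+ q
p<p+q p {q} 0<q = subst (ℚ._< p ℚ.+ q) (ℚₚ.+-identityʳ p) (ℚₚ.+-monoʳ-< p 0<q)

0<p*q : ∀ {p q} → 0ℚ ℚ.< p → 0ℚ ℚ.< q → 0ℚ ℚ.< p ℚ.* q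
0<p*q {p} {q} 0<p 0<q = subst (ℚ._< p ℚ.* q) (ℚₚ.*-zeroʳ p)
  (ℚₚ.*-monoʳ-<-pos p {{ℚ.positive 0<p}} 0<q)

0<½p : ∀ {p} → 0ℚ ℚ.< p → 0ℚ ℚ.< ½ ℚ.* p
0<½p = 0<p*q (ℚₚ.positive⁻¹ ½)

½p+½p≡p : ∀ p → ½ ℚ.* p ℚ.+ ½ ℚ.* p ≡ p
½p+½p≡p = solve 1 (λ p → con ½ :* p :+ con ½ :* p := p) refl

*-mono-≤-nonNeg : ∀ {p q r s} → 0ℚ ℚ.≤ p → 0ℚ ℚ.≤ r → p ℚ.≤ q → r ℚ.≤ s →
                  p ℚ.* r ℚ.≤ q ℚ.* s
*-mono-≤-nonNeg {q = q} {r = r} 0≤p 0≤r p≤q r≤s = ℚₚ.≤-trans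
  (ℚₚ.*-monoʳ-≤-nonNeg r {{ℚ.nonNegative 0≤r}} p≤q)
  (ℚₚ.*-monoˡ-≤-nonNeg q {{ℚ.nonNegative (ℚₚ.≤-trans 0≤p p≤q)}} r≤s)

∣p∣<q : ∀ {p q} → p ℚ.< q → ℚ.- p ℚ.< q → ∣ p ∣ ℚ.< q
∣p∣<q {p} p<q -p<q with ℚₚ.∣p∣≡p∨∣p∣≡-p p
... | inj₁ eq = subst (ℚ._< _) (sym eq) p<q
... | inj₂ eq = subst (ℚ._< _) (sym eq) -p<q

∣p-q∣<w : ∀ {l w p q} → l ℚ.≤ p → p ℚ.< l ℚ.+ w → l ℚ.≤ q → q ℚ.< l ℚ.+ w →
          ∣ p ℚ.- q ∣ ℚ.< w
∣p-q∣<w {l} {w} {p} {q} l≤p p<l+w l≤q q<l+w =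
  ∣p∣<q (aux l≤q p<l+w) (subst (ℚ._< w) (solve 2 (λ p q → q :- p := :- (p :- q)) refl p q)
                               (aux l≤p q<l+w))
  where
  aux : ∀ {a b} → l ℚ.≤ b → a ℚ.< l ℚ.+ w → a ℚ.- b ℚ.< w
  aux l≤b a<l+w = subst (_ ℚ.<_) (solve 2 (λ l w → l :+ w :- l := w) refl l w)
    (ℚₚ.+-mono-<-≤ a<l+w (ℚₚ.neg-antimono-≤ l≤b))

divide : ∀ {B} ε → 0ℚ ℚ.< B → 0ℚ ℚ.< ε → ∃[ δ ] 0ℚ ℚ.< δ × B ℚ.* δ ≡ ε
divide {B} ε 0<B 0<ε = 1/B ℚ.* ε , 0<p*q 0<1/B 0<ε ,
  trans (sym (ℚₚ.*-assoc B 1/B ε))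
        (trans (cong (ℚ._* ε) (ℚₚ.*-inverseʳ B)) (ℚₚ.*-identityˡ ε))
  where
  instance
    B-pos : ℚ.Positive B
    B-pos = ℚ.positive 0<B
    B-nonZero : ℚ.NonZero B
    B-nonZero = ℚ.>-nonZero 0<B
  1/B : ℚ
  1/B = ℚ.1/ B
  0<1/B : 0ℚ ℚ.< 1/B
  0<1/B = ℚₚ.positive⁻¹ 1/B {{ℚₚ.1/pos⇒pos B}}

½^ : ℕ → ℚ
½^ zero    = 1ℚ
½^ (suc n) = ½ ℚ.* ½^ n

0<½^ : ∀ n → 0ℚ ℚ.< ½^ n
0<½^ zero    = 0<1
0<½^ (suc n) = 0<½p (0<½^ n)

½^≤1 : ∀ n → ½^ n ℚ.≤ 1ℚ
½^≤1 zero    = ℚₚ.≤-refl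
½^≤1 (suc n) = ℚₚ.<⇒≤ (ℚₚ.<-≤-trans
  (subst (½^ (suc n) ℚ.<_) (½p+½p≡p (½^ n)) (p<p+q _ (0<½p (0<½^ n)))) (½^≤1 n))

½^-archimedean : ∀ ε → 0ℚ ℚ.< ε → ∃[ n ] ½^ n ℚ.< ε
½^-archimedean ε@(mkℚ +[1+ a ] d _) 0<ε = suc d , ℚₚ.≰⇒> λ ε≤½^ →
  ℚₚ.<-irrefl refl (ℚₚ.≤-<-trans (ℚₚ.≤-trans 1≤r*ε
    (ℚₚ.*-monoˡ-≤-nonNeg (r (suc d)) {{ℚ.nonNegative (0≤r (suc d))}} ε≤½^)) (r*½^<1 (suc d)))
  where
  r : ℕ → ℚ
  r zero    = 0ℚ
  r (suc n) = 1ℚ ℚ.+ r n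

  0≤r : ∀ n → 0ℚ ℚ.≤ r n
  0≤r zero    = ℚₚ.≤-refl
  0≤r (suc n) = ℚₚ.≤-trans (0≤r n)
    (subst (ℚ._≤ r (suc n)) (ℚₚ.+-identityˡ (r n)) (ℚₚ.+-monoˡ-≤ (r n) (ℚₚ.<⇒≤ 0<1)))

  r*½^<1 : ∀ n → r n ℚ.* ½^ n ℚ.< 1ℚ
  r*½^<1 zero    = 0<1
  r*½^<1 (suc n) = subst₂ ℚ._<_
    (solve 2 (λ r h → con ½ :* h :+ con ½ :* (r :* h) := (con 1ℚ :+ r) :* (con ½ :* h)) refl (r n) (½^ n))
    refl
    (ℚₚ.+-mono-≤-< (ℚₚ.*-monoˡ-≤-nonNeg ½ (½^≤1 n)) (ℚₚ.*-monoʳ-<-pos ½ (r*½^<1 n)))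

  toℚᵘ-r : ∀ n → ℚ.toℚᵘ (r n) ℚᵘ.≃ ℚᵘ.mkℚᵘ (+ n) 0
  toℚᵘ-r zero    = ℚᵘ.*≡* refl
  toℚᵘ-r (suc n) = ℚᵘₚ.≃-trans (ℚₚ.toℚᵘ-homo-+ 1ℚ (r n))
    (ℚᵘₚ.≃-trans (ℚᵘₚ.+-congʳ ℚᵘ.1ℚᵘ (toℚᵘ-r n))
      (ℚᵘ.*≡* (cong (λ k → (ℤ.1ℤ ℤ.+ k) ℤ.* ℤ.1ℤ) (ℤₚ.*-identityʳ (+ n)))))

  1≤r*ε : 1ℚ ℚ.≤ r (suc d) ℚ.* ε
  1≤r*ε = ℚₚ.toℚᵘ-cancel-≤ (ℚᵘₚ.≤-respʳ-≃
    (ℚᵘₚ.≃-sym (ℚᵘₚ.≃-trans (ℚₚ.toℚᵘ-homo-* (r (suc d)) ε) (ℚᵘₚ.*-congʳ (toℚᵘ-r (suc d)))))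
    (ℚᵘ.*≤* (ℤ.+≤+ (ℕ.s≤s (subst₂ ℕ._≤_
      (sym (trans (ℕₚ.+-identityʳ (d ℕ.+ 0)) (ℕₚ.+-identityʳ d)))
      (sym (ℕₚ.*-identityʳ (a ℕ.+ d ℕ.* suc a)))
      (ℕₚ.≤-trans (ℕₚ.m≤m*n d (suc a)) (ℕₚ.m≤n+m (d ℕ.* suc a) a)))))))
½^-archimedean (mkℚ (+ 0) _ _)      (ℚ.*<* (ℤ.+<+ ()))
½^-archimedean (mkℚ ℤ.-[1+ _ ] _ _) (ℚ.*<* ())

fromℚ : ℚ → ℝ
fromℚ p = mkℝ (λ _ → p) λ ε 0<ε → 0 , λ _ _ _ _ →
  subst (ℚ._< ε) (sym (cong ∣_∣ (ℚₚ.+-inverseʳ p))) 0<ε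

fromℕ : ℕ → ℝ
fromℕ n = fromℚ (+ n ℚ./ 1)

0ℝ : ℝ
0ℝ = fromℚ 0ℚ

infixl 6 _+_ _-_
infixl 7 _*_
infix  8 -_
infix  9 _²

_+_ : ℝ → ℝ → ℝ
x + y = mkℝ (λ n → seq x n ℚ.+ seq y n) λ ε 0<ε →
  let (N₁ , p) = cauchy x (½ ℚ.* ε) (0<½p 0<ε)
      (N₂ , q) = cauchy y (½ ℚ.* ε) (0<½p 0<ε)
  in N₁ ℕ.⊔ N₂ , λ m n N≤m N≤n → ℚₚ.≤-<-trans
       (≤-respˡ
         (cong ∣_∣ (solve 4 (λ a b c d → (a :- b) :+ (c :- d) := (a :+ c) :- (b :+ d)) refl
           (seq x m) (seq x n) (seq y m) (seq y n)))
         (ℚₚ.∣p+q∣≤∣p∣+∣q∣ (seq x m ℚ.- seq x n) (seq y m ℚ.- seq y n)))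
       (subst (_ ℚ.<_) (½p+½p≡p ε) (ℚₚ.+-mono-<
         (p m n (ℕₚ.m⊔n≤o⇒m≤o N₁ N₂ N≤m) (ℕₚ.m⊔n≤o⇒m≤o N₁ N₂ N≤n))
         (q m n (ℕₚ.m⊔n≤o⇒n≤o N₁ N₂ N≤m) (ℕₚ.m⊔n≤o⇒n≤o N₁ N₂ N≤n))))

-_ : ℝ → ℝ
- x = mkℝ (λ n → ℚ.- seq x n) λ ε 0<ε →
  let (N , p) = cauchy x ε 0<ε
  in N , λ m n N≤m N≤n → subst (ℚ._< ε)
       (trans (sym (ℚₚ.∣-p∣≡∣p∣ (seq x m ℚ.- seq x n)))
              (cong ∣_∣ (ℚₚ.neg-distrib-+ (seq x m) (ℚ.- seq x n))))
       (p m n N≤m N≤n)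

_-_ : ℝ → ℝ → ℝ
x - y = x + (- y)

bounded : ∀ x → ∃[ B ] 0ℚ ℚ.< B × ∃[ N ] ∀ n → N ℕ.≤ n → ∣ seq x n ∣ ℚ.≤ B
bounded x =
  let (N , p) = cauchy x 1ℚ 0<1
      a = ∣ seq x N ∣
  in a ℚ.+ 1ℚ , ℚₚ.≤-<-trans (ℚₚ.0≤∣p∣ (seq x N)) (p<p+q a 0<1) , N , λ n N≤n →
       ℚₚ.≤-trans
         (≤-respˡ
           (cong ∣_∣ (solve 2 (λ a b → a :+ (b :- a) := b) refl (seq x N) (seq x n)))
           (ℚₚ.∣p+q∣≤∣p∣+∣q∣ (seq x N) (seq x n ℚ.- seq x N)))
         (ℚₚ.+-monoʳ-≤ a (ℚₚ.<⇒≤ (p n N N≤n ℕₚ.≤-refl)))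

_*_ : ℝ → ℝ → ℝ
x * y = mkℝ (λ n → seq x n ℚ.* seq y n) λ ε 0<ε →
  let (B , 0<B , N₁ , p) = bounded x
      (C , 0<C , N₂ , q) = bounded y
      (δ , 0<δ , Bδ≡½ε)  = divide (½ ℚ.* ε) 0<B (0<½p 0<ε)
      (η , 0<η , Cη≡½ε)  = divide (½ ℚ.* ε) 0<C (0<½p 0<ε)
      (N₃ , r) = cauchy y δ 0<δ
      (N₄ , s) = cauchy x η 0<η
      N₁₂ = N₁ ℕ.⊔ N₂
      N₃₄ = N₃ ℕ.⊔ N₄
      l₁₂ = λ {m} (h : _ ℕ.≤ m) → ℕₚ.m⊔n≤o⇒m≤o N₁₂ N₃₄ h
      l₃₄ = λ {m} (h : _ ℕ.≤ m) → ℕₚ.m⊔n≤o⇒n≤o N₁₂ N₃₄ h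
      l₁  = λ {m} (h : _ ℕ.≤ m) → ℕₚ.m⊔n≤o⇒m≤o N₁ N₂ (l₁₂ h)
      l₂  = λ {m} (h : _ ℕ.≤ m) → ℕₚ.m⊔n≤o⇒n≤o N₁ N₂ (l₁₂ h)
      l₃  = λ {m} (h : _ ℕ.≤ m) → ℕₚ.m⊔n≤o⇒m≤o N₃ N₄ (l₃₄ h)
      l₄  = λ {m} (h : _ ℕ.≤ m) → ℕₚ.m⊔n≤o⇒n≤o N₃ N₄ (l₃₄ h)
  in N₁₂ ℕ.⊔ N₃₄ , λ m n N≤m N≤n →
     let xm = seq x m; xn = seq x n; ym = seq y m; yn = seq y n in
     ℚₚ.≤-<-trans
       (subst₂ ℚ._≤_
         (cong ∣_∣ (solve 4 (λ a b c d → a :* (c :- d) :+ d :* (a :- b) := a :* c :- b :* d)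
           refl xm xn ym yn))
         (cong₂ ℚ._+_ (ℚₚ.∣p*q∣≡∣p∣*∣q∣ xm (ym ℚ.- yn)) (ℚₚ.∣p*q∣≡∣p∣*∣q∣ yn (xm ℚ.- xn)))
         (ℚₚ.∣p+q∣≤∣p∣+∣q∣ (xm ℚ.* (ym ℚ.- yn)) (yn ℚ.* (xm ℚ.- xn))))
       (subst (_ ℚ.<_) (½p+½p≡p ε) (ℚₚ.+-mono-<
         (subst (_ ℚ.<_) Bδ≡½ε (scale 0<B (p m (l₁ N≤m)) (r m n (l₃ N≤m) (l₃ N≤n))))
         (subst (_ ℚ.<_) Cη≡½ε (scale 0<C (q n (l₂ N≤n)) (s m n (l₄ N≤m) (l₄ N≤n))))))
  where
  scale : ∀ {a b B δ} → 0ℚ ℚ.< B → ∣ a ∣ ℚ.≤ B → ∣ b ∣ ℚ.< δ →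
          ∣ a ∣ ℚ.* ∣ b ∣ ℚ.< B ℚ.* δ
  scale {b = b} {B = B} 0<B a≤B b<δ = ℚₚ.≤-<-trans
    (ℚₚ.*-monoʳ-≤-nonNeg ∣ b ∣ {{ℚₚ.∣-∣-nonNeg b}} a≤B)
    (ℚₚ.*-monoʳ-<-pos B {{ℚ.positive 0<B}} b<δ)

_² : ℝ → ℝ
x ² = x * x

inv : ℚ → ℚ
inv p with p ℚₚ.≟ 0ℚ
... | yes _   = 0ℚ
... | no  p≢0 = (ℚ.1/ p) {{ℚ.≢-nonZero p≢0}}

*-inv : ∀ {p} → 0ℚ ℚ.< p → p ℚ.* inv p ≡ 1ℚ
*-inv {p} 0<p with p ℚₚ.≟ 0ℚ
... | yes p≡0 = contradiction 0<p (ℚₚ.<-irrefl (sym p≡0))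
... | no  p≢0 = ℚₚ.*-inverseʳ p {{ℚ.≢-nonZero p≢0}}

recip : (x : ℝ) → Pos x → ℝ
recip x (δ , 0<δ , N₁ , δ≤x) = mkℝ (λ n → inv (seq x n)) λ ε 0<ε →
  let 0<δ²ε = 0<p*q (0<p*q 0<δ 0<δ) 0<ε
      (N₂ , c) = cauchy x (δ ℚ.* δ ℚ.* ε) 0<δ²ε
      l₁ = λ {m} (h : _ ℕ.≤ m) → ℕₚ.m⊔n≤o⇒m≤o N₁ N₂ h
      l₂ = λ {m} (h : _ ℕ.≤ m) → ℕₚ.m⊔n≤o⇒n≤o N₁ N₂ h
  in N₁ ℕ.⊔ N₂ , λ m n N≤m N≤n →
       bound (δ≤x m (l₁ N≤m)) (δ≤x n (l₁ N≤n)) (c n m (l₂ N≤n) (l₂ N≤m))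
  where
  bound : ∀ {p q ε} → δ ℚ.≤ p → δ ℚ.≤ q → ∣ q ℚ.- p ∣ ℚ.< δ ℚ.* δ ℚ.* ε →
          ∣ inv p ℚ.- inv q ∣ ℚ.< ε
  bound {p} {q} {ε} δ≤p δ≤q q-p<δ²ε =
    ℚₚ.*-cancelˡ-<-nonNeg (δ ℚ.* δ) {{ℚ.nonNegative (ℚₚ.<⇒≤ (0<p*q 0<δ 0<δ))}}
      (ℚₚ.≤-<-trans
        (subst (δ ℚ.* δ ℚ.* ∣ inv p ℚ.- inv q ∣ ℚ.≤_) pqd
          (ℚₚ.*-monoʳ-≤-nonNeg _ {{ℚₚ.∣-∣-nonNeg (inv p ℚ.- inv q)}}
            (*-mono-≤-nonNeg 0≤δ 0≤δ δ≤p δ≤q)))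
        q-p<δ²ε)
    where
    0≤δ = ℚₚ.<⇒≤ 0<δ
    0<p = ℚₚ.<-≤-trans 0<δ δ≤p
    0<q = ℚₚ.<-≤-trans 0<δ δ≤q
    pqd : p ℚ.* q ℚ.* ∣ inv p ℚ.- inv q ∣ ≡ ∣ q ℚ.- p ∣
    pqd = trans
      (cong (ℚ._* ∣ inv p ℚ.- inv q ∣) (sym (ℚₚ.0≤p⇒∣p∣≡p (ℚₚ.<⇒≤ (0<p*q 0<p 0<q)))))
      (trans (sym (ℚₚ.∣p*q∣≡∣p∣*∣q∣ (p ℚ.* q) (inv p ℚ.- inv q)))
        (cong ∣_∣ (trans
          (solve 4 (λ p q a b → p :* q :* (a :- b) := q :* (p :* a) :- p :* (q :* b)) refl
            p q (inv p) (inv q))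
          (trans
            (cong₂ (λ a b → q ℚ.* a ℚ.- p ℚ.* b) (*-inv 0<p) (*-inv 0<q))
            (cong₂ ℚ._-_ (ℚₚ.*-identityʳ q) (ℚₚ.*-identityʳ p))))))

-- Bisection of [a , a + 1], keeping the lower endpoint where P holds.
module Bisection (P : ℚ → Bool) (a : ℚ) where

  lo : ℕ → ℚ
  lo zero    = a
  lo (suc n) = let mid = lo n ℚ.+ ½^ (suc n) in if P mid then mid else lo n

  lo-step : ∀ n → lo n ℚ.≤ lo (suc n) × lo (suc n) ℚ.≤ lo n ℚ.+ ½^ (suc n)
  lo-step n with P (lo n ℚ.+ ½^ (suc n))
  ... | true  = ℚₚ.<⇒≤ (p<p+q (lo n) (0<½^ (suc n))) , ℚₚ.≤-refl
  ... | false = ℚₚ.≤-refl , ℚₚ.<⇒≤ (p<p+q (lo n) (0<½^ (suc n)))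

  lo-mono : ∀ n k → lo n ℚ.≤ lo (k ℕ.+ n)
  lo-mono n zero    = ℚₚ.≤-refl
  lo-mono n (suc k) = ℚₚ.≤-trans (lo-mono n k) (proj₁ (lo-step (k ℕ.+ n)))

  hi-mono : ∀ n k → lo (k ℕ.+ n) ℚ.+ ½^ (k ℕ.+ n) ℚ.≤ lo n ℚ.+ ½^ n
  hi-mono n zero    = ℚₚ.≤-refl
  hi-mono n (suc k) = ℚₚ.≤-trans
    (subst (lo (suc (k ℕ.+ n)) ℚ.+ ½^ (suc (k ℕ.+ n)) ℚ.≤_)
      (solve 2 (λ l h → l :+ con ½ :* h :+ con ½ :* h := l :+ h) refl (lo (k ℕ.+ n)) (½^ (k ℕ.+ n)))
      (ℚₚ.+-monoˡ-≤ (½^ (suc (k ℕ.+ n))) (proj₂ (lo-step (k ℕ.+ n)))))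
    (hi-mono n k)

  lo-within : ∀ {N n} → N ℕ.≤ n → lo N ℚ.≤ lo n × lo n ℚ.< lo N ℚ.+ ½^ N
  lo-within {N} {n} N≤n = subst (λ n → lo N ℚ.≤ lo n × lo n ℚ.< lo N ℚ.+ ½^ N) (ℕₚ.m∸n+n≡m N≤n)
    (lo-mono N (n ℕ.∸ N) ,
     ℚₚ.<-≤-trans (p<p+q _ (0<½^ (n ℕ.∸ N ℕ.+ N))) (hi-mono N (n ℕ.∸ N)))

  limit : ℝ
  limit = mkℝ lo λ ε 0<ε →
    let (N , ½^N<ε) = ½^-archimedean ε 0<ε
    in N , λ m n N≤m N≤n →
         let (a , b) = lo-within N≤m
             (c , d) = lo-within N≤n
         in ℚₚ.<-trans (∣p-q∣<w a b c d) ½^N<ε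

√2 : ℝ
√2 = Bisection.limit (λ q → does (q ℚ.* q ℚₚ.≤? + 2 ℚ./ 1)) 1ℚ

3+2√2 : ℝ
3+2√2 = fromℕ 3 + fromℕ 2 * √2

3+2√2-pos : Pos 3+2√2
3+2√2-pos = 1ℚ , 0<1 , 0 , λ n _ → ℚₚ.≤-trans
  (ℚₚ.≤ᵇ⇒≤ {1ℚ} {+ 5 ℚ./ 1} _)
  (ℚₚ.+-monoʳ-≤ (+ 3 ℚ./ 1) (ℚₚ.*-monoˡ-≤-nonNeg (+ 2 ℚ./ 1)
    (proj₁ (Bisection.lo-within (λ q → does (q ℚ.* q ℚₚ.≤? + 2 ℚ./ 1)) 1ℚ {n = n} ℕ.z≤n))))

1/[3+2√2] : ℝ
1/[3+2√2] = recip 3+2√2 3+2√2-pos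

+-0-rawMonoid : RawMonoid 0ℓ 0ℓ
+-0-rawMonoid = record { Carrier = ℝ ; _≈_ = _≃_ ; _∙_ = _+_ ; ε = 0ℝ }

open RawMonoidDefs +-0-rawMonoid public using (sum)
open RawMonoidDefs ℕ.+-0-rawMonoid public using () renaming (sum to sumℕ)

⟨_,_⟩ : ∀ {m} → Vector ℝ m → Vector ℝ m → ℝ
⟨ u , v ⟩ = sum λ e → u e * v e

∥_∥² : ∀ {m} → Vector ℝ m → ℝ
∥ u ∥² = ⟨ u , u ⟩

-- Jobs are numbered from 0 in order of arrival.  The set of hyperedges of a
-- job is presented by an enumeration without repetitions, so that
-- "i ∈ 𝒮ⱼ" becomes "i : Fin (size j)".
record Instance : Set where
  field
    #machines     : ℕ
    #jobs         : ℕ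
    size          : Fin #jobs → ℕ
    size-nonZero  : ∀ j → ℕ.NonZero (size j)
    edge          : ∀ j → Fin (size j) → Subset #machines
    edge-distinct : ∀ j → Injective _≡_ _≡_ (edge j)
    w             : Fin #machines → Fin #jobs → ℝ
    w-nonNeg      : ∀ e j → 0ℝ ≤ w e j

module _ (I : Instance) where
  open Instance I

  Assignment : Set
  Assignment = ∀ j → Vector ℕ (size j)

  IsSolution : Assignment → Set
  IsSolution x = (∀ j i → x j i ≡ 0 ⊎ x j i ≡ 1) × (∀ j → sumℕ (x j) ≡ 1)

  -- L_e^{(t)}: the load due to the first t jobs.  For the job j : Fin #jobs, the
  -- load just before its arrival is therefore load x (toℕ j).
  load : Assignment → ℕ → Fin #machines → ℝ
  load x t e = sum λ k → if does (toℕ k ℕₚ.<? t)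
    then w e k * sum (λ i → if does (e ∈? edge k i) then fromℕ (x k i) else 0ℝ)
    else 0ℝ

  cost : Assignment → ℝ
  cost x = sum λ e → load x #jobs e ²

  -- The increase of the objective if job j, arriving after the jobs before it
  -- have been assigned according to x, is put on its hyperedge i.
  increase : Assignment → (j : Fin #jobs) → Fin (size j) → ℝ
  increase x j i =
    (sum λ e → (load x (toℕ j) e + (if does (e ∈? edge j i) then w e j else 0ℝ)) ²)
    - (sum λ e → load x (toℕ j) e ²)

  IsGreedy : Assignment → Set
  IsGreedy x = IsSolution x ×
    (∀ j i → x j i ≡ 1 → ∀ i′ → increase x j i ≤ increase x j i′)

  -- The minimum cost over all solutions.  It is a predicate because the minimum
  -- of finitely many reals is not always constructively attained.
  IsOPT : ℝ → Set
  IsOPT o = (∃[ x ] IsSolution x × cost x ≃ o) × (∀ x → IsSolution x → o ≤ cost x)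

  record SDPVariables : Set where
    field
      y : Vector ℝ #jobs
      ν : Vector ℝ #machines
      v : ∀ j → Fin (size j) → Vector ℝ #machines

  module _ (d : SDPVariables) where
    open SDPVariables d

    SDPFeasible : Set
    SDPFeasible =
      (∀ j i → y j ≤ sum (λ e → if does (e ∈? edge j i) then w e j ² else 0ℝ)
                     - fromℚ ½ * ∥ v j i ∥² + ⟨ ν , v j i ⟩)
      × (∀ j i k i′ → _≢_ {A = Σ (Fin #jobs) λ j → Fin (size j)} (j , i) (k , i′) →
         ⟨ v j i , v k i′ ⟩
           ≤ fromℕ 2 * sum (λ e → if does (e ∈? edge j i ∩ edge k i′) then w e j * w e k else 0ℝ))

    SDPObjective : ℝ
    SDPObjective = sum y - fromℚ ½ * ∥ ν ∥²

{-# OPTIONS --safe #-}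
module Submission where

-- Dual fitting.  Let L be the final loads of Greedy and put α = 2^{1/4}, τ = 1 − α²/2,
-- κ = τ α³.  Take ν = κ L, v_{ij} = α (w_{ej} 1[e ∈ i])_e and y_j = τ times the increase of
-- the objective caused by job j.  Since the increase Σ_{e∈i} (w² + 2 L^{(j-1)} w) is minimal
-- at Greedy's hyperedge and L^{(j-1)} ≤ L, the first constraint reduces to
-- 1 − α²/2 = τ and α κ = 2 τ, and the second one to α² ≤ 2.  The increases telescope to
-- the cost, so the objective is (τ − κ²/2) Σ L² = (3 − 2√2) Σ L².
-- For the competitive ratio, comparing Greedy with the hyperedges of a solution of loads L′
-- gives Σ L² ≤ Σ L′² + 2 Σ L L′, and the mixed term is absorbed by Σ ((√2 − 1) L − L′)² ≥ 0.

open import Algebra.Bundles using (CommutativeRing)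
open import Algebra.Core using (Op₁; Op₂)
import Algebra.Properties.CommutativeMonoid.Sum as Sum
import Algebra.Properties.Semiring.Sum as SemiringSum
import Algebra.Solver.Ring as RingSolver
open import Algebra.Solver.Ring.AlmostCommutativeRing
  using (_-Raw-AlmostCommutative⟶_; Induced-equivalence; fromCommutativeRing)
open import Algebra.Structures using (IsCommutativeRing)
open import Data.Bool.Base using (Bool; true; false; if_then_else_; _∧_)
open import Data.Bool.Properties using (∧-idem)
open import Data.Fin.Base using (Fin; zero; suc; toℕ)
open import Data.Fin.Properties using (toℕ<n)
open import Data.Fin.Subset using (Subset; _∩_)
open import Data.Fin.Subset.Properties using (_∈?_; x∈p∩q⁺; x∈p∩q⁻)
open import Data.Integer.Base using (+_)
import Data.Maybe.Base as Maybe
open import Data.Nat.Base as ℕ using (ℕ; zero; suc)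
import Data.Nat.Properties as ℕₚ
open import Data.Product.Base using (Σ; ∃-syntax; _×_; _,_; proj₁; proj₂)
open import Data.Rational.Base as ℚ using (ℚ; 0ℚ; 1ℚ; ½; ∣_∣)
import Data.Rational.Properties as ℚₚ
open import Data.Rational.Solver using (module +-*-Solver)
open import Data.Sum.Base using (_⊎_; inj₁; inj₂)
open import Data.Vec.Functional using (Vector)
open import Function.Base using (_∘_)
open import Level using (0ℓ)
open import Relation.Binary.Core using (Rel)
open import Relation.Binary.Definitions using (WeaklyDecidable)
open import Relation.Binary.PropositionalEquality using (_≡_)
import Relation.Binary.PropositionalEquality as ≡
import Relation.Binary.Reasoning.Setoid as ≈-Reasoning
open import Relation.Binary.Structures using (IsPreorder)
open import Relation.Nullary.Decidable using (Dec; yes; no; does; dec-true; dec-false; dec⇒maybe)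
open import Defs using (sumℕ)

-- Ordered ℚ-algebras

-- The interface over which the algebra of the proof is carried out. Order on Cauchy reals cannot be
-- decided, so it is only a preorder and `0≤x*x` is a field instead of a consequence of totality.
record IsOrderedℚAlgebra {A : Set} (_≈_ _≤_ : Rel A 0ℓ) (_+_ _*_ : Op₂ A) (-_ : Op₁ A)
                         (0# 1# : A) (⟦_⟧ : ℚ → A) : Set where
  field
    isCommutativeRing : IsCommutativeRing _≈_ _+_ _*_ -_ 0# 1#
    ≤-isPreorder      : IsPreorder _≈_ _≤_
    +-mono-≤          : ∀ {x y u v} → x ≤ y → u ≤ v → (x + u) ≤ (y + v)
    0≤x*y             : ∀ {x y} → 0# ≤ x → 0# ≤ y → 0# ≤ (x * y)
    0≤x*x             : ∀ x → 0# ≤ (x * x)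
    +-homo            : ∀ p q → ⟦ p ℚ.+ q ⟧ ≈ (⟦ p ⟧ + ⟦ q ⟧)
    *-homo            : ∀ p q → ⟦ p ℚ.* q ⟧ ≈ (⟦ p ⟧ * ⟦ q ⟧)
    -‿homo            : ∀ p → ⟦ ℚ.- p ⟧ ≈ (- ⟦ p ⟧)
    0-homo            : ⟦ 0ℚ ⟧ ≈ 0#
    1-homo            : ⟦ 1ℚ ⟧ ≈ 1#
    0≤⟦_⟧             : ∀ {q} → 0ℚ ℚ.≤ q → 0# ≤ ⟦ q ⟧

record OrderedℚAlgebra : Set₁ where
  constructor mkOrderedℚAlgebra
  infix  4 _≈_ _≤_
  infixl 6 _+_
  infixl 7 _*_
  infix  8 -_
  field
    Carrier           : Set
    _≈_ _≤_           : Rel Carrier 0ℓ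
    _+_ _*_           : Op₂ Carrier
    -_                : Op₁ Carrier
    0# 1#             : Carrier
    ⟦_⟧               : ℚ → Carrier
    isOrderedℚAlgebra : IsOrderedℚAlgebra _≈_ _≤_ _+_ _*_ -_ 0# 1# ⟦_⟧

  open IsOrderedℚAlgebra isOrderedℚAlgebra public

  commutativeRing : CommutativeRing 0ℓ 0ℓ
  commutativeRing = record { isCommutativeRing = isCommutativeRing }

  open CommutativeRing commutativeRing public
    using (setoid; semiring; +-commutativeMonoid; refl; sym; trans; reflexive; _-_;
           +-cong; +-congˡ; +-congʳ; +-comm; +-assoc; +-identityˡ; +-identityʳ;
           *-cong; *-congˡ; *-congʳ; *-identityʳ; zeroˡ; zeroʳ; -‿cong; -‿inverseʳ)
  open IsPreorder ≤-isPreorder public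
    using () renaming (refl to ≤-refl; reflexive to ≤-reflexive; trans to ≤-trans;
                       ≲-respˡ-≈ to ≤-respˡ-≈; ≲-respʳ-≈ to ≤-respʳ-≈)

  ℚ-morphism : ℚ.+-*-rawRing -Raw-AlmostCommutative⟶ fromCommutativeRing commutativeRing
  ℚ-morphism = record
    { ⟦_⟧ = ⟦_⟧ ; +-homo = +-homo ; *-homo = *-homo ; -‿homo = -‿homo
    ; 0-homo = 0-homo ; 1-homo = 1-homo }

  _coeff≟_ : WeaklyDecidable (Induced-equivalence ℚ-morphism)
  p coeff≟ q = Maybe.map (λ p≡q → reflexive (≡.cong ⟦_⟧ p≡q)) (dec⇒maybe (p ℚₚ.≟ q))

  open RingSolver ℚ.+-*-rawRing (fromCommutativeRing commutativeRing) ℚ-morphism _coeff≟_ public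
    using (solve; con; _:+_; _:-_; _:*_; :-_; _:=_)

-- Inequalities and finite sums in an ordered ℚ-algebra

module OrderedℚAlgebraProperties (A : OrderedℚAlgebra) where
  open OrderedℚAlgebra A
  open Sum +-commutativeMonoid using (sum; sum-cong-≋; ∑-distrib-+; ∑-comm; sum-replicate-zero)
  open SemiringSum semiring using (*-distribˡ-sum)
  open ≈-Reasoning setoid

  ½# 2# 3# : Carrier
  ½# = ⟦ ½ ⟧
  2# = ⟦ + 2 ℚ./ 1 ⟧
  3# = ⟦ + 3 ℚ./ 1 ⟧

  -- Reduces an inequality to a nonnegative slack `z` and a ring identity, which the solver can
  -- check.
  ≤-by-gap : ∀ {x y z} → 0# ≤ z → x + z ≈ y → x ≤ y
  ≤-by-gap {x} 0≤z x+z≈y = ≤-respˡ-≈ (+-identityʳ x) (≤-respʳ-≈ x+z≈y (+-mono-≤ ≤-refl 0≤z))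

  0≤y-x : ∀ {x y} → x ≤ y → 0# ≤ y - x
  0≤y-x {x} x≤y = ≤-respˡ-≈ (-‿inverseʳ x) (+-mono-≤ x≤y ≤-refl)

  0≤x+y : ∀ {x y} → 0# ≤ x → 0# ≤ y → 0# ≤ x + y
  0≤x+y 0≤x 0≤y = ≤-respˡ-≈ (+-identityʳ 0#) (+-mono-≤ 0≤x 0≤y)

  0≤con : ∀ {q} {_ : ℚ.NonNegative q} → 0# ≤ ⟦ q ⟧
  0≤con {q} {q≥0} = 0≤⟦ ℚₚ.nonNegative⁻¹ q {{q≥0}} ⟧

  *-monoˡ-≤ : ∀ {z x y} → 0# ≤ z → x ≤ y → z * x ≤ z * y
  *-monoˡ-≤ {z} {x} {y} 0≤z x≤y = ≤-by-gap (0≤x*y 0≤z (0≤y-x x≤y))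
    (solve 3 (λ z x y → z :* x :+ z :* (y :- x) := z :* y) refl z x y)

  sum-mono-≤ : ∀ {n} {f g : Vector Carrier n} → (∀ i → f i ≤ g i) → sum f ≤ sum g
  sum-mono-≤ {zero}  f≤g = ≤-refl
  sum-mono-≤ {suc n} f≤g = +-mono-≤ (f≤g zero) (sum-mono-≤ (λ i → f≤g (suc i)))

  0≤sum : ∀ {n} {f : Vector Carrier n} → (∀ i → 0# ≤ f i) → 0# ≤ sum f
  0≤sum {n} 0≤f = ≤-respˡ-≈ (sum-replicate-zero n) (sum-mono-≤ 0≤f)

  -- Splitting off the first entry leaves the cross term `2 (f zero) (sum (f ∘ suc))` as slack, and
  -- it is nonnegative.
  sum-squares≤square-sum : ∀ {n} {f : Vector Carrier n} → (∀ i → 0# ≤ f i) →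
                           sum (λ i → f i * f i) ≤ sum f * sum f
  sum-squares≤square-sum {zero}      0≤f = 0≤x*x 0#
  sum-squares≤square-sum {suc n} {f} 0≤f = ≤-trans
    (+-mono-≤ ≤-refl (sum-squares≤square-sum (λ i → 0≤f (suc i))))
    (≤-by-gap (0≤x*y (0≤con {+ 2 ℚ./ 1}) (0≤x*y (0≤f zero) (0≤sum (λ i → 0≤f (suc i)))))
      (solve 2 (λ x y → x :* x :+ y :* y :+ con (+ 2 ℚ./ 1) :* (x :* y) := (x :+ y) :* (x :+ y))
        refl (f zero) (sum (f ∘ suc))))

  sum-telescopes : ∀ n (Φ : ℕ → Carrier) →
                   sum {n} (λ j → Φ (suc (toℕ j)) - Φ (toℕ j)) ≈ Φ n - Φ 0
  sum-telescopes zero    Φ = sym (-‿inverseʳ (Φ 0))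
  sum-telescopes (suc n) Φ = trans (+-congˡ (sum-telescopes n (Φ ∘ suc)))
    (solve 3 (λ a b c → (b :- a) :+ (c :- b) := c :- a) refl (Φ 0) (Φ 1) (Φ (suc n)))

  -- Prefix sums, the shape in which loads are defined

  prefix : ∀ {n} → Vector Carrier n → ℕ → Carrier
  prefix f t = sum λ k → if does (toℕ k ℕₚ.<? t) then f k else 0#

  prefix-zero : ∀ {n} (f : Vector Carrier n) → prefix f 0 ≈ 0#
  prefix-zero {n} f = sum-replicate-zero n

  -- Induction on `j`: the test for `suc k` against `suc t` computes to the test for `k` against
  -- `t`, so the tail is again a prefix sum.
  prefix-suc : ∀ {n} (f : Vector Carrier n) j → prefix f (suc (toℕ j)) ≈ prefix f (toℕ j) + f j
  prefix-suc {suc n} f zero = trans (+-congˡ (sum-replicate-zero n))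
    (trans (+-comm (f zero) 0#) (+-congʳ (sym (trans (+-congˡ (sum-replicate-zero n)) (+-identityʳ 0#)))))
  prefix-suc {suc n} f (suc j) = trans (+-congˡ (prefix-suc (f ∘ suc) j)) (sym (+-assoc _ _ _))

  prefix-all : ∀ {n} (f : Vector Carrier n) → prefix f n ≈ sum f
  prefix-all {n} f = sum-cong-≋ λ k →
    reflexive (≡.cong (if_then f k else 0#) (dec-true (toℕ k ℕₚ.<? n) (toℕ<n k)))

  prefix≤sum : ∀ {n} {f : Vector Carrier n} → (∀ k → 0# ≤ f k) → ∀ t → prefix f t ≤ sum f
  prefix≤sum {f = f} 0≤f t = sum-mono-≤ λ k → aux k (does (toℕ k ℕₚ.<? t))
    where
    aux : ∀ k b → (if b then f k else 0#) ≤ f k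
    aux k true  = ≤-refl
    aux k false = 0≤f k

  -- Indicators and one-hot vectors

  if-0≤ : ∀ b {x} → 0# ≤ x → 0# ≤ (if b then x else 0#)
  if-0≤ true  0≤x = 0≤x
  if-0≤ false 0≤x = ≤-refl

  -- Turns indicators of an intersection into products. The factors are given up to `≈` so that `u`
  -- and `v` may be opaque.
  if-* : ∀ {a b c x y u v} → c ≡ a ∧ b →
         (if a then x else 0#) ≈ u → (if b then y else 0#) ≈ v → (if c then x * y else 0#) ≈ u * v
  if-* {true}  {true}  ≡.refl x≈u y≈v = *-cong x≈u y≈v
  if-* {true}  {false} ≡.refl x≈u 0≈v = sym (trans (*-congˡ (sym 0≈v)) (zeroʳ _))
  if-* {false}         ≡.refl 0≈u y≈v = sym (trans (*-congʳ (sym 0≈u)) (zeroˡ _))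

  fromℕ# : ℕ → Carrier
  fromℕ# k = ⟦ + k ℚ./ 1 ⟧

  zero-select : ∀ {n} (x : Vector ℕ n) → sumℕ x ≡ 0 → ∀ (p : Fin n → Bool) →
                sum (λ i → if p i then fromℕ# (x i) else 0#) ≈ 0#
  zero-select {zero}  x Σx≡0 p = refl
  zero-select {suc n} x Σx≡0 p = trans
    (+-cong (aux (p zero) (ℕₚ.m+n≡0⇒m≡0 (x zero) Σx≡0))
            (zero-select (x ∘ suc) (ℕₚ.m+n≡0⇒n≡0 (x zero) Σx≡0) (p ∘ suc)))
    (+-identityʳ 0#)
    where
    aux : ∀ b {k} → k ≡ 0 → (if b then fromℕ# k else 0#) ≈ 0#
    aux true  ≡.refl = 0-homo
    aux false _      = refl

  -- Passes from 0/1 variables to a chosen index. The index precedes the quantifier over `p`,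
  -- because one hyperedge has to serve all machines; the factor `y` becomes the weight.
  one-hot-select : ∀ {n} (x : Vector ℕ n) → (∀ i → x i ≡ 0 ⊎ x i ≡ 1) → sumℕ x ≡ 1 →
                   ∃[ i ] x i ≡ 1 × (∀ (p : Fin n → Bool) y →
                     y * sum (λ i → if p i then fromℕ# (x i) else 0#) ≈ (if p i then y else 0#))
  one-hot-select {suc n} x x∈01 Σx≡1 with x zero in x₀ | x∈01 zero | Σx≡1
  -- If the first entry is 0, the tail still sums to 1; if it is 1, the tail sums to 0 and
  -- `zero-select` removes it.
  ... | _ | inj₁ ≡.refl | Σx≡1′ =
    let (i , xᵢ≡1 , select) = one-hot-select (x ∘ suc) (x∈01 ∘ suc) Σx≡1′
    in suc i , xᵢ≡1 , λ p y →
       trans (*-congˡ (trans (+-congʳ (aux (p zero))) (+-identityˡ _))) (select (p ∘ suc) y)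
    where
    aux : ∀ b → (if b then fromℕ# 0 else 0#) ≈ 0#
    aux true  = 0-homo
    aux false = refl
  ... | _ | inj₂ ≡.refl | Σx≡1′ = zero , x₀ , λ p y →
    trans (*-congˡ (trans (+-congˡ (zero-select (x ∘ suc) (ℕₚ.suc-injective Σx≡1′) (p ∘ suc)))
                          (+-identityʳ _)))
          (aux (p zero) y)
    where
    aux : ∀ b y → y * (if b then fromℕ# 1 else 0#) ≈ (if b then y else 0#)
    aux true  y = trans (*-congˡ 1-homo) (*-identityʳ y)
    aux false y = zeroʳ y

  -- Since `x² − y² = (x − y)(x + y)`, an inverse `z` of `x + y` allows cancellation.
  positive-root-unique : ∀ {x y z} → (x + y) * z ≈ 1# → x * x ≈ y * y → x ≈ y
  positive-root-unique {x} {y} {z} [x+y]z≈1 x²≈y² = begin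
    x                               ≈⟨ solve 2 (λ x y → x := y :+ (x :- y)) refl x y ⟩
    y + (x - y)                     ≈⟨ +-congˡ (*-identityʳ (x - y)) ⟨
    y + (x - y) * 1#                ≈⟨ +-congˡ (*-congˡ [x+y]z≈1) ⟨
    y + (x - y) * ((x + y) * z)     ≈⟨ solve 3 (λ x y z → y :+ (x :- y) :* ((x :+ y) :* z)
                                                := y :+ (x :* x :- y :* y) :* z) refl x y z ⟩
    y + (x * x - y * y) * z         ≈⟨ +-congˡ (*-congʳ (trans (+-congʳ x²≈y²) (-‿inverseʳ (y * y)))) ⟩
    y + 0# * z                      ≈⟨ +-congˡ (zeroˡ z) ⟩
    y + 0#                          ≈⟨ +-identityʳ y ⟩
    y                               ∎

  -- Sums occurring in the dual constraints

  increase-expand : ∀ {m} (p c b : Vector Carrier m) → (∀ e → c e ≈ b e) →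
                    (sum λ e → (p e + c e) * (p e + c e)) - (sum λ e → p e * p e)
                      ≈ sum λ e → b e * b e + (p e * b e + p e * b e)
  increase-expand p c b c≈b = trans
    (+-congʳ (trans
      (sum-cong-≋ λ e → trans (*-cong (+-congˡ (c≈b e)) (+-congˡ (c≈b e)))
        (solve 2 (λ p b → (p :+ b) :* (p :+ b) := p :* p :+ (b :* b :+ (p :* b :+ p :* b)))
          refl (p e) (b e)))
      (∑-distrib-+ (λ e → p e * p e) (λ e → b e * b e + (p e * b e + p e * b e)))))
    (solve 2 (λ x y → x :+ y :- x := y) refl _ _)

  -- The common shape of the right side of the first dual constraint and of an expanded sum of
  -- squares of differences.
  sum-linear : ∀ {n} x (f g h : Vector Carrier n) →
               sum f - x * sum g + sum h ≈ sum λ i → f i - x * g i + h i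
  sum-linear {zero}  x f g h =
    trans (+-identityʳ _) (trans (+-congˡ (-‿cong (zeroʳ x))) (-‿inverseʳ 0#))
  sum-linear {suc n} x f g h = trans
    (solve 7 (λ x f g h F G H → (f :+ F) :- x :* (g :+ G) :+ (h :+ H)
                                := (f :- x :* g :+ h) :+ (F :- x :* G :+ H)) refl
      x (f zero) (g zero) (h zero) (sum (f ∘ suc)) (sum (g ∘ suc)) (sum (h ∘ suc)))
    (+-congˡ (sum-linear x (f ∘ suc) (g ∘ suc) (h ∘ suc)))

  -- The second dual constraint, with `s` for the indicator sum over the intersection. It holds
  -- machine by machine with slack `(2 − x²) u v`.
  gram≤ : ∀ {m} {x} {u v s : Vector Carrier m} →
          x * x ≤ 2# → (∀ e → 0# ≤ u e) → (∀ e → 0# ≤ v e) → (∀ e → s e ≈ u e * v e) →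
          sum (λ e → x * u e * (x * v e)) ≤ 2# * sum s
  gram≤ {x = x} {u} {v} {s} x²≤2 0≤u 0≤v s≈uv =
    ≤-respʳ-≈ (sym (*-distribˡ-sum 2# s)) (sum-mono-≤ λ e →
      ≤-by-gap (0≤x*y (0≤y-x x²≤2) (0≤x*y (0≤u e) (0≤v e)))
        (trans (solve 3 (λ x u v → x :* u :* (x :* v) :+ (con (+ 2 ℚ./ 1) :- x :* x) :* (u :* v)
                                   := con (+ 2 ℚ./ 1) :* (u :* v)) refl x (u e) (v e))
               (*-congˡ (sym (s≈uv e)))))

  -- b j is the vector of loads which job j adds, and load t the loads after the first t jobs.
  module Loads {m n} (load : ℕ → Vector Carrier m) (b : Fin n → Vector Carrier m)
               (load-zero : ∀ e → load 0 e ≈ 0#)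
               (load-suc : ∀ j e → load (suc (toℕ j)) e ≈ load (toℕ j) e + b j e)
               (load-mono : ∀ (j : Fin n) e → load (toℕ j) e ≤ load n e) where

    -- This is `Σ (p + c)² − Σ p²` for the loads `p` just before job `j`, expanded.
    gain : Fin n → Vector Carrier m → Carrier
    gain j c = sum λ e → c e * c e + (load (toℕ j) e * c e + load (toℕ j) e * c e)

    Cost : Carrier
    Cost = sum λ e → load n e * load n e

    load≈Σb : ∀ e → load n e ≈ sum λ j → b j e
    load≈Σb e = sym (begin
      sum (λ j → b j e)
        ≈⟨ sum-cong-≋ (λ j → solve 2 (λ x y → y := x :+ y :- x) refl (load (toℕ j) e) (b j e)) ⟩
      sum (λ j → load (toℕ j) e + b j e - load (toℕ j) e)
        ≈⟨ sum-cong-≋ (λ j → +-congʳ (load-suc j e)) ⟨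
      sum {n} (λ j → load (suc (toℕ j)) e - load (toℕ j) e)
        ≈⟨ sum-telescopes n (λ t → load t e) ⟩
      load n e - load 0 e
        ≈⟨ +-congˡ (-‿cong (trans (load-zero e) (sym 0-homo))) ⟩
      load n e - ⟦ 0ℚ ⟧
        ≈⟨ solve 1 (λ x → x :- con 0ℚ := x) refl (load n e) ⟩
      load n e ∎)

    -- Each gain is one difference of the potential `Φ t`, the sum of squared loads after `t` jobs,
    -- and `Φ 0` vanishes.
    Σgain≈Cost : sum (λ j → gain j (b j)) ≈ Cost
    Σgain≈Cost = begin
      sum (λ j → gain j (b j))
        ≈⟨ sum-cong-≋ step ⟩
      sum {n} (λ j → Φ (suc (toℕ j)) - Φ (toℕ j))
        ≈⟨ sum-telescopes n Φ ⟩
      Cost - Φ 0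
        ≈⟨ +-congˡ (-‿cong (trans Φ0≈0 (sym 0-homo))) ⟩
      Cost - ⟦ 0ℚ ⟧
        ≈⟨ solve 1 (λ x → x :- con 0ℚ := x) refl Cost ⟩
      Cost ∎
      where
      Φ : ℕ → Carrier
      Φ t = sum λ e → load t e * load t e
      Φ0≈0 : Φ 0 ≈ 0#
      Φ0≈0 = trans (sum-cong-≋ λ e → trans (*-congʳ (load-zero e)) (zeroˡ _)) (sum-replicate-zero m)
      step : ∀ j → gain j (b j) ≈ Φ (suc (toℕ j)) - Φ (toℕ j)
      step j = trans (sym (increase-expand (load (toℕ j)) (b j) (b j) (λ _ → refl)))
        (+-congʳ (sum-cong-≋ λ e → *-cong (sym (load-suc j e)) (sym (load-suc j e))))

    -- Loads only grow, so replacing the load before `j` by the final one costs the slack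
    -- `2 (l − p) c`.
    gain≤ : ∀ j {c} → (∀ e → 0# ≤ c e) → gain j c ≤ sum λ e → c e * c e + 2# * (load n e * c e)
    gain≤ j {c} 0≤c = sum-mono-≤ λ e →
      ≤-by-gap (0≤x*y (0≤con {+ 2 ℚ./ 1}) (0≤x*y (0≤y-x (load-mono j e)) (0≤c e)))
        (solve 3 (λ p l c → c :* c :+ (p :* c :+ p :* c) :+ con (+ 2 ℚ./ 1) :* ((l :- p) :* c)
                            := c :* c :+ con (+ 2 ℚ./ 1) :* (l :* c)) refl (load (toℕ j) e) (load n e) (c e))

  -- The constants are variables, so that an instance may keep them opaque; K is 3 + 2√2.
  module Constants (α s τ κ K : Carrier) (s≈α² : s ≈ α * α) (s²≈2 : s * s ≈ 2#) (s≤2 : s ≤ 2#)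
                   (τ≈ : τ ≈ ½# * (2# - α * α)) (κ≈ : κ ≈ τ * α * (α * α))
                   (K≈ : K ≈ 3# + 2# * s) where

    -- This is √2, written through `α` so that the identities below are polynomial in one constant.
    r : Carrier
    r = α * α

    r²≈2 : r * r ≈ 2#
    r²≈2 = trans (sym (*-cong s≈α² s≈α²)) s²≈2

    r≤2 : r ≤ 2#
    r≤2 = ≤-respˡ-≈ s≈α² s≤2

    κ≈′ : κ ≈ ½# * (2# - r) * α * r
    κ≈′ = trans κ≈ (*-congʳ (*-congʳ τ≈))

    K≈′ : K ≈ 3# + 2# * r
    K≈′ = trans K≈ (+-congˡ (*-congˡ s≈α²))

    -- Calculation modulo the relation `r² = 2`, which the ring solver does not know; `z` is the
    -- cofactor of `r² − 2`.
    modulo-r²-2 : ∀ z {x y} → x ≈ y + z * (r * r - 2#) → x ≈ y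
    modulo-r²-2 z {y = y} x≈ = trans x≈ (trans
      (+-congˡ (trans (*-congˡ (trans (+-congʳ r²≈2) (-‿inverseʳ 2#))) (zeroʳ z)))
      (+-identityʳ y))

    0≤r : 0# ≤ r
    0≤r = 0≤x*x α

    0≤τ : 0# ≤ τ
    0≤τ = ≤-respʳ-≈ (sym τ≈) (0≤x*y (0≤con {½}) (0≤y-x r≤2))

    module Dual {m n} (load : ℕ → Vector Carrier m) (b : Fin n → Vector Carrier m)
      (load-zero : ∀ e → load 0 e ≈ 0#)
      (load-suc : ∀ j e → load (suc (toℕ j)) e ≈ load (toℕ j) e + b j e)
      (load-mono : ∀ (j : Fin n) e → load (toℕ j) e ≤ load n e)
      (inc : Fin n → Carrier)
      (inc≈gain : ∀ j → inc j ≈ Loads.gain load b load-zero load-suc load-mono j (b j))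
      where
      open Loads load b load-zero load-suc load-mono

      dual-feasible : ∀ j {s c} → (∀ e → 0# ≤ c e) → (∀ e → s e ≈ c e * c e) →
        inc j ≤ gain j c →
        τ * inc j ≤ sum s - ½# * sum (λ e → α * c e * (α * c e)) + sum (λ e → κ * load n e * (α * c e))
      dual-feasible j {s} {c} 0≤c s≈c² greedy = ≤-trans
        (*-monoˡ-≤ 0≤τ (≤-trans greedy (gain≤ j 0≤c)))
        (≤-reflexive (trans (*-distribˡ-sum {n = m} τ _) (trans (sum-cong-≋ λ e → sym (term e))
          (sym (sum-linear ½# s _ _)))))
        where
        term : ∀ e → s e - ½# * (α * c e * (α * c e)) + κ * load n e * (α * c e)
                     ≈ τ * (c e * c e + 2# * (load n e * c e))
        term e = trans
          (+-cong (+-congʳ (s≈c² e)) (*-congʳ (*-congʳ κ≈′)))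
          -- The square terms give `1 − r/2 = τ`. The mixed term has coefficient `κ α = τ r²`, which
          -- exceeds `2 τ` by `τ (r² − 2)`; hence the cofactor.
          (trans (modulo-r²-2 (½# * (2# - r) * (load n e * c e))
            (solve 3 (λ α l c →
              let r = α :* α
                  τ = con ½ :* (con (+ 2 ℚ./ 1) :- r)
              in c :* c :- con ½ :* (α :* c :* (α :* c)) :+ τ :* α :* r :* l :* (α :* c)
                 := τ :* (c :* c :+ con (+ 2 ℚ./ 1) :* (l :* c))
                    :+ τ :* (l :* c) :* (r :* r :- con (+ 2 ℚ./ 1)))
              refl α (load n e) (c e)))
            (*-congʳ (sym τ≈)))

      dual-objective : ∀ {ρ} → K * ρ ≈ 1# →
        ρ * Cost ≈ sum (λ j → τ * inc j) - ½# * sum (λ e → κ * load n e * (κ * load n e))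
      dual-objective {ρ} Kρ≈1 = trans (*-congʳ ρ≈τ-½κ²) (trans
        (solve 3 (λ t k a → (t :- con ½ :* (k :* k)) :* a := t :* a :- con ½ :* (k :* k :* a))
          refl τ κ Cost)
        (+-cong (trans (*-congˡ (sym (trans (sum-cong-≋ inc≈gain) Σgain≈Cost))) (*-distribˡ-sum {n = n} τ _))
          (-‿cong (*-congˡ (trans (*-distribˡ-sum {n = m} (κ * κ) _) (sum-cong-≋ λ e →
            solve 2 (λ k l → k :* k :* (l :* l) := k :* l :* (k :* l)) refl κ (load n e)))))))
        where
        -- Here `(3 − 2r)(3 + 2r) = 9 − 4r²`, which is 1 when `r² = 2`.
        ρ≈3-2r : ρ ≈ 3# - 2# * r
        ρ≈3-2r = sym (trans (sym (*-identityʳ _)) (trans (*-congˡ (trans (sym Kρ≈1) (*-congʳ K≈′)))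
          (modulo-r²-2 (⟦ ℚ.- (+ 4 ℚ./ 1) ⟧ * ρ) (solve 2 (λ r ρ →
            (con (+ 3 ℚ./ 1) :- con (+ 2 ℚ./ 1) :* r) :* ((con (+ 3 ℚ./ 1) :+ con (+ 2 ℚ./ 1) :* r) :* ρ)
            := ρ :+ con (ℚ.- (+ 4 ℚ./ 1)) :* ρ :* (r :* r :- con (+ 2 ℚ./ 1))) refl r ρ))))

        -- Modulo `r² = 2` one has `κ² = τ² r³ = 3r − 4`. The cofactor is the quotient of
        -- `(3 − 2r) − (τ − κ²/2)` by `r² − 2`.
        ρ≈τ-½κ² : ρ ≈ τ - ½# * (κ * κ)
        ρ≈τ-½κ² = trans ρ≈3-2r (trans
          (modulo-r²-2 (⟦ + 1 ℚ./ 8 ⟧ * (r * r * r) - ½# * (r * r) + ⟦ + 3 ℚ./ 4 ⟧ * r - ⟦ 1ℚ ⟧)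
            (solve 1 (λ α →
              let r = α :* α
                  τ = con ½ :* (con (+ 2 ℚ./ 1) :- r)
                  κ = τ :* α :* r
              in con (+ 3 ℚ./ 1) :- con (+ 2 ℚ./ 1) :* r
                 := τ :- con ½ :* (κ :* κ)
                    :+ (con (+ 1 ℚ./ 8) :* (r :* r :* r) :- con ½ :* (r :* r) :+ con (+ 3 ℚ./ 4) :* r
                        :- con 1ℚ)
                       :* (r :* r :- con (+ 2 ℚ./ 1)))
              refl α))
          (sym (+-cong τ≈ (-‿cong (*-congˡ (*-cong κ≈′ κ≈′))))))

    module Competitor {m n} (load : ℕ → Vector Carrier m) (b : Fin n → Vector Carrier m)
      (load-zero : ∀ e → load 0 e ≈ 0#)
      (load-suc : ∀ j e → load (suc (toℕ j)) e ≈ load (toℕ j) e + b j e)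
      (load-mono : ∀ (j : Fin n) e → load (toℕ j) e ≤ load n e)
      (load′ : ℕ → Vector Carrier m) (b′ : Fin n → Vector Carrier m)
      (load′-zero : ∀ e → load′ 0 e ≈ 0#)
      (load′-suc : ∀ j e → load′ (suc (toℕ j)) e ≈ load′ (toℕ j) e + b′ j e)
      (load′-mono : ∀ (j : Fin n) e → load′ (toℕ j) e ≤ load′ n e)
      (0≤b′ : ∀ j e → 0# ≤ b′ j e) where

      open Loads load b load-zero load-suc load-mono
      open Loads load′ b′ load′-zero load′-suc load′-mono
        using () renaming (Cost to Cost′; load≈Σb to load′≈Σb′)

      Mixed : Carrier
      Mixed = sum λ e → load n e * load′ n e

      -- Greedy is compared with the competitor's hyperedge job by job. After summing over jobs and
      -- exchanging the sums, the squares of the competitor's contributions to a machine are at most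
      -- its squared load there.
      Cost≤ : (∀ j → gain j (b j) ≤ gain j (b′ j)) →
              Cost ≤ Cost′ + 2# * Mixed
      Cost≤ greedy = ≤-respˡ-≈ Σgain≈Cost (≤-trans
        (sum-mono-≤ λ j → ≤-trans (greedy j) (gain≤ j (0≤b′ j)))
        (≤-trans (≤-reflexive (∑-comm λ j e → b′ j e * b′ j e + 2# * (load n e * b′ j e)))
          (≤-respʳ-≈ (trans (∑-distrib-+ (λ e → load′ n e * load′ n e) (λ e → 2# * (load n e * load′ n e)))
                            (+-congˡ (sym (*-distribˡ-sum {n = m} 2# _))))
            (sum-mono-≤ machine))))
        where
        machine : ∀ e → sum (λ j → b′ j e * b′ j e + 2# * (load n e * b′ j e)) 
                      ≤ load′ n e * load′ n e + 2# * (load n e * load′ n e)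
        machine e = ≤-respˡ-≈ (sym (∑-distrib-+ (λ j → b′ j e * b′ j e) (λ j → 2# * (load n e * b′ j e))))
          (+-mono-≤
            (≤-respʳ-≈ (sym (*-cong (load′≈Σb′ e) (load′≈Σb′ e))) (sum-squares≤square-sum (λ j → 0≤b′ j e)))
            (≤-reflexive (sym (trans
              (*-congˡ (trans (*-congˡ (load′≈Σb′ e)) (*-distribˡ-sum {n = n} (load n e) _)))
              (*-distribˡ-sum {n = n} 2# _)))))

      -- The right side is `Σ (l L − L′)²`, expanded.
      0≤quadratic : ∀ l → 0# ≤ l * l * Cost - 2# * l * Mixed + Cost′
      0≤quadratic l = ≤-respʳ-≈
        (trans (sum-cong-≋ λ e → solve 3 (λ l a b → (l :* a :- b) :* (l :* a :- b)
                 := l :* l :* (a :* a) :- con (+ 2 ℚ./ 1) :* l :* (a :* b) :+ b :* b)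
                 refl l (load n e) (load′ n e))
          (trans (sym (sum-linear (2# * l) (λ e → l * l * (load n e * load n e))
                        (λ e → load n e * load′ n e) (λ e → load′ n e * load′ n e)))
                 (+-congʳ (+-congʳ (sym (*-distribˡ-sum {n = m} (l * l) _))))))
        (0≤sum λ e → 0≤x*x (l * load n e - load′ n e))

      -- Modulo r² = 2 and with A, B, X for Cost, Cost′, Mixed,
      -- (3 + 2r) B − A = (1 + r/2) (B + 2X − A) + (2 + 3r/2) ((r − 1)² A − 2 (r − 1) X + B).
      competitive : (∀ j → gain j (b j) ≤ gain j (b′ j)) →
                    Cost ≤ K * Cost′
      competitive greedy = ≤-respʳ-≈ (*-congʳ (sym K≈′)) (≤-by-gap
        (0≤x+y (0≤x*y (0≤x+y (0≤con {1ℚ}) (0≤x*y (0≤con {½}) 0≤r)) (0≤y-x (Cost≤ greedy)))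
               (0≤x*y (0≤x+y (0≤con {+ 2 ℚ./ 1}) (0≤x*y (0≤con {+ 3 ℚ./ 2}) 0≤r))
                      (0≤quadratic (r - ⟦ 1ℚ ⟧))))
        (modulo-r²-2 ((⟦ + 3 ℚ./ 2 ⟧ * r - ⟦ 1ℚ ⟧) * Cost - 3# * Mixed)
          (solve 4 (λ r a x b →
            a :+ ((con 1ℚ :+ con ½ :* r) :* (b :+ con (+ 2 ℚ./ 1) :* x :- a)
                  :+ (con (+ 2 ℚ./ 1) :+ con (+ 3 ℚ./ 2) :* r)
                     :* ((r :- con 1ℚ) :* (r :- con 1ℚ) :* a
                         :- con (+ 2 ℚ./ 1) :* (r :- con 1ℚ) :* x :+ b))
            := (con (+ 3 ℚ./ 1) :+ con (+ 2 ℚ./ 1) :* r) :* b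
               :+ ((con (+ 3 ℚ./ 2) :* r :- con 1ℚ) :* a :- con (+ 3 ℚ./ 1) :* x)
                  :* (r :* r :- con (+ 2 ℚ./ 1)))
            refl r Cost Mixed Cost′)))

-- The reals as an ordered ℚ-algebra

open import Defs hiding (sumℕ)

module Q = +-*-Solver
open Q using () renaming (_:=_ to _⊜_; _:+_ to _⊕_; _:*_ to _⊗_; _:-_ to _⊖_; :-_ to ⊝_)

-- Eventual statements and rational estimates

Eventually : (ℕ → Set) → Set
Eventually P = ∃[ N ] ∀ n → N ℕ.≤ n → P n

always : ∀ {P} → (∀ n → P n) → Eventually P
always p = 0 , λ n _ → p n

zipEventually : ∀ {P Q R : ℕ → Set} → (∀ n → P n → Q n → R n) →
                Eventually P → Eventually Q → Eventually R
zipEventually f (M , p) (N , q) = M ℕ.⊔ N , λ n M⊔N≤n →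
  f n (p n (ℕₚ.m⊔n≤o⇒m≤o M N M⊔N≤n)) (q n (ℕₚ.m⊔n≤o⇒n≤o M N M⊔N≤n))

mapEventually : ∀ {P Q : ℕ → Set} → (∀ n → P n → Q n) → Eventually P → Eventually Q
mapEventually f (N , p) = N , λ n N≤n → f n (p n N≤n)

p≤∣p∣ : ∀ p → p ℚ.≤ ∣ p ∣
p≤∣p∣ p with ℚₚ.≤-total 0ℚ p
... | inj₁ 0≤p = ℚₚ.≤-reflexive (≡.sym (ℚₚ.0≤p⇒∣p∣≡p 0≤p))
... | inj₂ p≤0 = ℚₚ.≤-trans p≤0 (ℚₚ.0≤∣p∣ p)

0≤q*q : ∀ q → 0ℚ ℚ.≤ q ℚ.* q
0≤q*q q with ℚₚ.≤-total 0ℚ q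
... | inj₁ 0≤q = *-mono-≤-nonNeg ℚₚ.≤-refl ℚₚ.≤-refl 0≤q 0≤q
... | inj₂ q≤0 = ≡.subst (0ℚ ℚ.≤_) (Q.solve 1 (λ q → ⊝ q ⊗ ⊝ q ⊜ q ⊗ q) ≡.refl q)
  (*-mono-≤-nonNeg ℚₚ.≤-refl ℚₚ.≤-refl 0≤-q 0≤-q)
  where
  0≤-q : 0ℚ ℚ.≤ ℚ.- q
  0≤-q = ℚₚ.neg-antimono-≤ q≤0

p≤q+ε : ∀ {p q ε} → p ℚ.- q ℚ.≤ ε → p ℚ.≤ q ℚ.+ ε
p≤q+ε {p} {q} {ε} p-q≤ε = ≡.subst (ℚ._≤ q ℚ.+ ε) (Q.solve 2 (λ p q → q ⊕ (p ⊖ q) ⊜ p) ≡.refl p q)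
  (ℚₚ.+-monoʳ-≤ q p-q≤ε)

p-q≤ε : ∀ {p q ε} → p ℚ.≤ q ℚ.+ ε → p ℚ.- q ℚ.≤ ε
p-q≤ε {p} {q} {ε} p≤q+ε = ≡.subst (p ℚ.- q ℚ.≤_) (Q.solve 2 (λ q ε → q ⊕ ε ⊖ q ⊜ ε) ≡.refl q ε)
  (ℚₚ.+-monoˡ-≤ (ℚ.- q) p≤q+ε)

½ε<ε : ∀ {ε} → 0ℚ ℚ.< ε → ½ ℚ.* ε ℚ.< ε
½ε<ε {ε} 0<ε = ≡.subst (½ ℚ.* ε ℚ.<_) (½p+½p≡p ε) (p<p+q _ (0<½p 0<ε))

∣0∣<ε : ∀ {p ε} → p ≡ 0ℚ → 0ℚ ℚ.< ε → ∣ p ∣ ℚ.< ε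
∣0∣<ε ≡.refl 0<ε = 0<ε

∣a+b∣<ε : ∀ {a b ε} p → a ℚ.+ b ≡ p → ∣ a ∣ ℚ.< ½ ℚ.* ε → ∣ b ∣ ℚ.< ½ ℚ.* ε → ∣ p ∣ ℚ.< ε
∣a+b∣<ε {a} {b} {ε} _ ≡.refl ∣a∣< ∣b∣< = ℚₚ.≤-<-trans (ℚₚ.∣p+q∣≤∣p∣+∣q∣ a b)
  (≡.subst (∣ a ∣ ℚ.+ ∣ b ∣ ℚ.<_) (½p+½p≡p ε) (ℚₚ.+-mono-< ∣a∣< ∣b∣<))

-- Equality of reals and the ring laws

≃-eventually : ∀ x y → Eventually (λ n → seq x n ≡ seq y n) → x ≃ y
≃-eventually x y x≡y ε 0<ε = mapEventually
  (λ n eq → ∣0∣<ε (≡.trans (≡.cong (ℚ._- seq y n) eq) (ℚₚ.+-inverseʳ (seq y n))) 0<ε) x≡y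

≃-pointwise : ∀ x y → (∀ n → seq x n ≡ seq y n) → x ≃ y
≃-pointwise x y x≡y = ≃-eventually x y (always x≡y)

≃-sym : ∀ x y → x ≃ y → y ≃ x
≃-sym x y x≃y ε 0<ε = mapEventually
  (λ n → ≡.subst (ℚ._< ε) (≡.trans (≡.sym (ℚₚ.∣-p∣≡∣p∣ (seq x n ℚ.- seq y n)))
    (≡.cong ∣_∣ (Q.solve 2 (λ a b → ⊝ (a ⊖ b) ⊜ b ⊖ a) ≡.refl (seq x n) (seq y n)))))
  (x≃y ε 0<ε)

≃-trans : ∀ x y z → x ≃ y → y ≃ z → x ≃ z
≃-trans x y z x≃y y≃z ε 0<ε = zipEventually
  (λ n → ∣a+b∣<ε (seq x n ℚ.- seq z n)
    (Q.solve 3 (λ a b c → (a ⊖ b) ⊕ (b ⊖ c) ⊜ a ⊖ c) ≡.refl (seq x n) (seq y n) (seq z n)))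
  (x≃y _ (0<½p 0<ε)) (y≃z _ (0<½p 0<ε))

+-cong : ∀ x y u v → x ≃ y → u ≃ v → x + u ≃ y + v
+-cong x y u v x≃y u≃v ε 0<ε = zipEventually
  (λ n → ∣a+b∣<ε (seq x n ℚ.+ seq u n ℚ.- (seq y n ℚ.+ seq v n))
    (Q.solve 4 (λ a b c d → (a ⊖ b) ⊕ (c ⊖ d) ⊜ (a ⊕ c) ⊖ (b ⊕ d)) ≡.refl
      (seq x n) (seq y n) (seq u n) (seq v n)))
  (x≃y _ (0<½p 0<ε)) (u≃v _ (0<½p 0<ε))

-‿cong : ∀ x y → x ≃ y → - x ≃ - y
-‿cong x y x≃y ε 0<ε = mapEventually
  (λ n → ≡.subst (ℚ._< ε) (≡.trans (≡.sym (ℚₚ.∣-p∣≡∣p∣ (seq x n ℚ.- seq y n)))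
    (≡.cong ∣_∣ (Q.solve 2 (λ a b → ⊝ (a ⊖ b) ⊜ ⊝ a ⊖ ⊝ b) ≡.refl (seq x n) (seq y n)))))
  (x≃y ε 0<ε)

-- Beyond some index `z` is bounded by `B`, so closeness `δ` of `x` and `y` with `B δ = ε` suffices.
*-congˡ : ∀ z x y → x ≃ y → z * x ≃ z * y
*-congˡ z x y x≃y ε 0<ε =
  let (B , 0<B , ∣z∣≤B)  = bounded z
      (δ , 0<δ , Bδ≡ε) = divide ε 0<B 0<ε
  in zipEventually
    (λ n ∣z∣≤B ∣x-y∣<δ → ≡.subst₂ ℚ._<_
      (≡.trans (≡.sym (ℚₚ.∣p*q∣≡∣p∣*∣q∣ (seq z n) (seq x n ℚ.- seq y n)))
        (≡.cong ∣_∣ (Q.solve 3 (λ a b c → a ⊗ (b ⊖ c) ⊜ a ⊗ b ⊖ a ⊗ c) ≡.refl (seq z n) (seq x n) (seq y n))))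
      Bδ≡ε
      (ℚₚ.≤-<-trans
        (ℚₚ.*-monoʳ-≤-nonNeg ∣ seq x n ℚ.- seq y n ∣ {{ℚₚ.∣-∣-nonNeg (seq x n ℚ.- seq y n)}} ∣z∣≤B)
        (ℚₚ.*-monoʳ-<-pos B {{ℚ.positive 0<B}} ∣x-y∣<δ)))
    ∣z∣≤B (x≃y δ 0<δ)

*-comm : ∀ x y → x * y ≃ y * x
*-comm x y = ≃-pointwise (x * y) (y * x) λ n → ℚₚ.*-comm (seq x n) (seq y n)

*-cong : ∀ x y u v → x ≃ y → u ≃ v → x * u ≃ y * v
*-cong x y u v x≃y u≃v = ≃-trans (x * u) (x * v) (y * v) (*-congˡ x u v u≃v)
  (≃-trans (x * v) (v * x) (y * v) (*-comm x v)
    (≃-trans (v * x) (v * y) (y * v) (*-congˡ v x y x≃y) (*-comm v y)))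

-- Apart from equivalence and congruence, every law holds term by term in ℚ.
isCommutativeRing : IsCommutativeRing _≃_ _+_ _*_ -_ 0ℝ (fromℚ 1ℚ)
isCommutativeRing = record
  { isRing = record
    { +-isAbelianGroup = record
      { isGroup = record
        { isMonoid = record
          { isSemigroup = record
            { isMagma = record
              { isEquivalence = record
                { refl  = λ {x} → ≃-pointwise x x λ _ → ≡.refl
                ; sym   = λ {x} {y} → ≃-sym x y
                ; trans = λ {x} {y} {z} → ≃-trans x y z
                }
              ; ∙-cong = λ {x} {y} {u} {v} → +-cong x y u v
              }
            ; assoc = λ x y z → ≃-pointwise (x + y + z) (x + (y + z)) λ n →
                ℚₚ.+-assoc (seq x n) (seq y n) (seq z n)
            }
          ; identity = (λ x → ≃-pointwise (0ℝ + x) x λ n → ℚₚ.+-identityˡ (seq x n))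
                     , (λ x → ≃-pointwise (x + 0ℝ) x λ n → ℚₚ.+-identityʳ (seq x n))
          }
        ; inverse = (λ x → ≃-pointwise (- x + x) 0ℝ λ n → ℚₚ.+-inverseˡ (seq x n))
                  , (λ x → ≃-pointwise (x - x) 0ℝ λ n → ℚₚ.+-inverseʳ (seq x n))
        ; ⁻¹-cong = λ {x} {y} → -‿cong x y
        }
      ; comm = λ x y → ≃-pointwise (x + y) (y + x) λ n → ℚₚ.+-comm (seq x n) (seq y n)
      }
    ; *-cong = λ {x} {y} {u} {v} → *-cong x y u v
    ; *-assoc = λ x y z → ≃-pointwise (x * y * z) (x * (y * z)) λ n →
        ℚₚ.*-assoc (seq x n) (seq y n) (seq z n)
    ; *-identity = (λ x → ≃-pointwise (fromℚ 1ℚ * x) x λ n → ℚₚ.*-identityˡ (seq x n))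
                 , (λ x → ≃-pointwise (x * fromℚ 1ℚ) x λ n → ℚₚ.*-identityʳ (seq x n))
    ; distrib = (λ x y z → ≃-pointwise (x * (y + z)) (x * y + x * z) λ n →
                   ℚₚ.*-distribˡ-+ (seq x n) (seq y n) (seq z n))
              , (λ x y z → ≃-pointwise ((y + z) * x) (y * x + z * x) λ n →
                   ℚₚ.*-distribʳ-+ (seq x n) (seq y n) (seq z n))
    }
  ; *-comm = *-comm
  }

-- Order of the reals

≤-pointwise : ∀ x y → (∀ n → seq x n ℚ.≤ seq y n) → x ≤ y
≤-pointwise x y x≤y ε 0<ε = always λ n → ℚₚ.≤-trans (x≤y n) (ℚₚ.<⇒≤ (p<p+q (seq y n) 0<ε))

≃⇒≤ : ∀ x y → x ≃ y → x ≤ y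
≃⇒≤ x y x≃y ε 0<ε = mapEventually
  (λ n ∣x-y∣<ε → p≤q+ε (ℚₚ.≤-trans (p≤∣p∣ (seq x n ℚ.- seq y n)) (ℚₚ.<⇒≤ ∣x-y∣<ε)))
  (x≃y ε 0<ε)

≤-trans : ∀ x y z → x ≤ y → y ≤ z → x ≤ z
≤-trans x y z x≤y y≤z ε 0<ε = zipEventually
  (λ n x≤y+½ε y≤z+½ε → ℚₚ.≤-trans x≤y+½ε
    (≡.subst (seq y n ℚ.+ ½ ℚ.* ε ℚ.≤_)
      (≡.trans (ℚₚ.+-assoc (seq z n) _ _) (≡.cong (seq z n ℚ.+_) (½p+½p≡p ε)))
      (ℚₚ.+-monoˡ-≤ (½ ℚ.* ε) y≤z+½ε)))
  (x≤y _ (0<½p 0<ε)) (y≤z _ (0<½p 0<ε))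

-- `≤` yields weak bounds while `≃` asks for strict ones, so both hypotheses are taken at `ε/2`.
≤-antisym : ∀ x y → x ≤ y → y ≤ x → x ≃ y
≤-antisym x y x≤y y≤x ε 0<ε = zipEventually
  (λ n x≤y+½ε y≤x+½ε → ∣p∣<q (ℚₚ.≤-<-trans (p-q≤ε x≤y+½ε) (½ε<ε 0<ε))
    (≡.subst (ℚ._< ε) (Q.solve 2 (λ a b → b ⊖ a ⊜ ⊝ (a ⊖ b)) ≡.refl (seq x n) (seq y n))
      (ℚₚ.≤-<-trans (p-q≤ε y≤x+½ε) (½ε<ε 0<ε))))
  (x≤y _ (0<½p 0<ε)) (y≤x _ (0<½p 0<ε))

+-mono-≤ : ∀ x y u v → x ≤ y → u ≤ v → x + u ≤ y + v
+-mono-≤ x y u v x≤y u≤v ε 0<ε = zipEventually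
  (λ n x≤y+½ε u≤v+½ε → ≡.subst (seq x n ℚ.+ seq u n ℚ.≤_)
    (≡.trans (Q.solve 3 (λ a b c → (a ⊕ c) ⊕ (b ⊕ c) ⊜ (a ⊕ b) ⊕ (c ⊕ c)) ≡.refl
               (seq y n) (seq v n) (½ ℚ.* ε))
             (≡.cong (seq y n ℚ.+ seq v n ℚ.+_) (½p+½p≡p ε)))
    (ℚₚ.+-mono-≤ x≤y+½ε u≤v+½ε))
  (x≤y _ (0<½p 0<ε)) (u≤v _ (0<½p 0<ε))

-- From x ≥ −δ and y ≥ −η we get x y ≥ −δ (y + η) − η x; with |x| ≤ B and |y| ≤ C,
-- η is chosen with B η = ε/2 and then δ with (C + η) δ = ε/2.
0≤x*y : ∀ x y → 0ℝ ≤ x → 0ℝ ≤ y → 0ℝ ≤ x * y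
0≤x*y x y 0≤x 0≤y ε 0<ε =
  let (B , 0<B , ∣x∣≤B)      = bounded x
      (C , 0<C , ∣y∣≤C)      = bounded y
      (η , 0<η , Bη≡½ε)      = divide (½ ℚ.* ε) 0<B (0<½p 0<ε)
      0<C+η                  = ℚₚ.<-trans 0<C (p<p+q C 0<η)
      (δ , 0<δ , [C+η]δ≡½ε)  = divide (½ ℚ.* ε) 0<C+η (0<½p 0<ε)
  in zipEventually (λ n (x≤B , 0≤x+δ) (y≤C , 0≤y+η) → bound 0<η 0<δ Bη≡½ε [C+η]δ≡½ε
        (ℚₚ.≤-trans (p≤∣p∣ (seq x n)) x≤B) (ℚₚ.≤-trans (p≤∣p∣ (seq y n)) y≤C) 0≤x+δ 0≤y+η)
      (zipEventually (λ _ → _,_) ∣x∣≤B (0≤x δ 0<δ))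
      (zipEventually (λ _ → _,_) ∣y∣≤C (0≤y η 0<η))
  where
  bound : ∀ {a b B C δ η} → 0ℚ ℚ.< η → 0ℚ ℚ.< δ → B ℚ.* η ≡ ½ ℚ.* ε → (C ℚ.+ η) ℚ.* δ ≡ ½ ℚ.* ε →
          a ℚ.≤ B → b ℚ.≤ C → 0ℚ ℚ.≤ a ℚ.+ δ → 0ℚ ℚ.≤ b ℚ.+ η → 0ℚ ℚ.≤ a ℚ.* b ℚ.+ ε
  bound {a} {b} {B} {C} {δ} {η} 0<η 0<δ Bη≡½ε [C+η]δ≡½ε a≤B b≤C 0≤a+δ 0≤b+η = ℚₚ.≤-trans
    (*-mono-≤-nonNeg ℚₚ.≤-refl ℚₚ.≤-refl 0≤a+δ 0≤b+η)
    (≡.subst₂ ℚ._≤_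
      (Q.solve 4 (λ a b δ η → a ⊗ b ⊕ (a ⊗ η ⊕ (b ⊕ η) ⊗ δ) ⊜ (a ⊕ δ) ⊗ (b ⊕ η)) ≡.refl a b δ η)
      (≡.cong (a ℚ.* b ℚ.+_) (≡.trans (≡.cong₂ ℚ._+_ Bη≡½ε [C+η]δ≡½ε) (½p+½p≡p ε)))
      (ℚₚ.+-monoʳ-≤ (a ℚ.* b) (ℚₚ.+-mono-≤
        (ℚₚ.*-monoʳ-≤-nonNeg η {{ℚ.nonNegative (ℚₚ.<⇒≤ 0<η)}} a≤B)
        (ℚₚ.*-monoʳ-≤-nonNeg δ {{ℚ.nonNegative (ℚₚ.<⇒≤ 0<δ)}} (ℚₚ.+-monoˡ-≤ η b≤C)))))

≤-isPreorder : IsPreorder _≃_ _≤_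
≤-isPreorder = record
  { isEquivalence = IsCommutativeRing.isEquivalence isCommutativeRing
  ; reflexive     = λ {x} {y} → ≃⇒≤ x y
  ; trans         = λ {x} {y} {z} → ≤-trans x y z
  }

ℝ-isOrderedℚAlgebra : IsOrderedℚAlgebra _≃_ _≤_ _+_ _*_ -_ 0ℝ (fromℚ 1ℚ) fromℚ
ℝ-isOrderedℚAlgebra = record
  { isCommutativeRing = isCommutativeRing
  ; ≤-isPreorder      = ≤-isPreorder
  ; +-mono-≤          = λ {x} {y} {u} {v} → +-mono-≤ x y u v
  ; 0≤x*y             = λ {x} {y} → 0≤x*y x y
  ; 0≤x*x             = λ x → ≤-pointwise 0ℝ (x * x) λ n → 0≤q*q (seq x n)
  ; +-homo            = λ p q → ≃-pointwise (fromℚ (p ℚ.+ q)) (fromℚ p + fromℚ q) λ _ → ≡.refl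
  ; *-homo            = λ p q → ≃-pointwise (fromℚ (p ℚ.* q)) (fromℚ p * fromℚ q) λ _ → ≡.refl
  ; -‿homo            = λ p → ≃-pointwise (fromℚ (ℚ.- p)) (- fromℚ p) λ _ → ≡.refl
  ; 0-homo            = ≃-pointwise 0ℝ 0ℝ λ _ → ≡.refl
  ; 1-homo            = ≃-pointwise (fromℚ 1ℚ) (fromℚ 1ℚ) λ _ → ≡.refl
  ; 0≤⟦_⟧             = λ {q} 0≤q → ≤-pointwise 0ℝ (fromℚ q) λ _ → 0≤q
  }

-- With a constructor application the operations of the instantiated lemmas reduce
-- at once to those of ℝ; a named instance would make conversion checking unfold
-- both sides down to their Cauchy proofs.
open OrderedℚAlgebraProperties
  (mkOrderedℚAlgebra ℝ _≃_ _≤_ _+_ _*_ -_ 0ℝ (fromℚ 1ℚ) fromℚ ℝ-isOrderedℚAlgebra)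

-- The reciprocal inverts termwise, and from the index in `x>0` on the terms are at least `δ > 0`.
x*recip[x]≃1 : ∀ x x>0 → x * recip x x>0 ≃ fromℚ 1ℚ
x*recip[x]≃1 x x>0@(δ , 0<δ , δ≤x) = ≃-eventually (x * recip x x>0) (fromℚ 1ℚ)
  (mapEventually (λ n δ≤xₙ → *-inv (ℚₚ.<-≤-trans 0<δ δ≤xₙ)) δ≤x)

-- Square and fourth roots of 2

½^-anti-≤ : ∀ {m n} → m ℕ.≤ n → ½^ n ℚ.≤ ½^ m
½^-anti-≤ {m} {n} m≤n = ≡.subst (λ n → ½^ n ℚ.≤ ½^ m) (ℕₚ.m∸n+n≡m m≤n) (go (n ℕ.∸ m))
  where
  go : ∀ k → ½^ (k ℕ.+ m) ℚ.≤ ½^ m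
  go zero    = ℚₚ.≤-refl
  go (suc k) = ℚₚ.≤-trans (ℚₚ.<⇒≤ (½ε<ε (0<½^ (k ℕ.+ m)))) (go k)

½^<ε : ∀ {ε} → 0ℚ ℚ.< ε → Eventually (λ n → ½^ n ℚ.< ε)
½^<ε {ε} 0<ε =
  let (N , ½^N<ε) = ½^-archimedean ε 0<ε
  in N , λ n N≤n → ℚₚ.≤-<-trans (½^-anti-≤ N≤n) ½^N<ε

-- The interval widths of the bisection as a real number: added to `limit` they give the upper
-- endpoints.
halves : ℝ
halves = mkℝ ½^ λ ε 0<ε →
  let (N , ½^<ε′) = ½^<ε 0<ε
      below = λ n N≤n → ≡.subst (½^ n ℚ.<_) (≡.sym (ℚₚ.+-identityˡ ε)) (½^<ε′ n N≤n)
  in N , λ m n N≤m N≤n →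
       ∣p-q∣<w (ℚₚ.<⇒≤ (0<½^ m)) (below m N≤m) (ℚₚ.<⇒≤ (0<½^ n)) (below n N≤n)

halves≃0 : halves ≃ 0ℝ
halves≃0 ε 0<ε = mapEventually
  (λ n ½^n<ε → ≡.subst (ℚ._< ε)
    (≡.trans (≡.sym (ℚₚ.0≤p⇒∣p∣≡p (ℚₚ.<⇒≤ (0<½^ n)))) (≡.cong ∣_∣ (≡.sym (ℚₚ.+-identityʳ (½^ n)))))
    ½^n<ε)
  (½^<ε 0<ε)

module Root (f : ℚ → ℚ) (c a : ℚ) (f[a]≤c : f a ℚ.≤ c) (c≤f[a+1] : c ℚ.≤ f (a ℚ.+ 1ℚ)) where
  open Bisection (λ q → does (f q ℚₚ.≤? c)) a public

  -- The bisection invariant: `f` is at most `c` at the lower endpoint and at least `c` at the upper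
  -- one.
  bracket : ∀ n → f (lo n) ℚ.≤ c × c ℚ.≤ f (lo n ℚ.+ ½^ n)
  bracket zero = f[a]≤c , c≤f[a+1]
  bracket (suc n) = step (f mid ℚₚ.≤? c)
    where
    mid : ℚ
    mid = lo n ℚ.+ ½^ (suc n)
    -- Abstracting the decision lets the `if` reduce. On `yes` the upper endpoint stays, rewritten
    -- as `mid` plus the new width; on `no` it becomes `mid`.
    step : (d : Dec (f mid ℚ.≤ c)) → let q = if does d then mid else lo n in
           f q ℚ.≤ c × c ℚ.≤ f (q ℚ.+ ½^ (suc n))
    step (yes f[mid]≤c) = f[mid]≤c , ≡.subst (λ q → c ℚ.≤ f q)
      (Q.solve 2 (λ l h → l ⊕ h ⊜ l ⊕ Q.con ½ ⊗ h ⊕ Q.con ½ ⊗ h) ≡.refl (lo n) (½^ n))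
      (proj₂ (bracket n))
    step (no f[mid]≰c)  = proj₁ (bracket n) , ℚₚ.<⇒≤ (ℚₚ.≰⇒> f[mid]≰c)

  -- Lower and upper endpoints represent the same real, so congruence of `F` plays the part of
  -- continuity and `bracket` bounds `F limit` from both sides.
  f[limit]≃c : (F : ℝ → ℝ) → (∀ x n → seq (F x) n ≡ f (seq x n)) → (∀ x y → x ≃ y → F x ≃ F y) →
               F limit ≃ fromℚ c
  f[limit]≃c F F-seq F-cong = ≤-antisym (F limit) (fromℚ c)
    (≤-pointwise (F limit) (fromℚ c) λ n →
      ≡.subst (ℚ._≤ c) (≡.sym (F-seq limit n)) (proj₁ (bracket n)))
    (≤-trans (fromℚ c) (F upper) (F limit)
      (≤-pointwise (fromℚ c) (F upper) λ n →
        ≡.subst (c ℚ.≤_) (≡.sym (F-seq upper n)) (proj₂ (bracket n)))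
      (≃⇒≤ (F upper) (F limit) (F-cong upper limit upper≃limit)))
    where
    upper : ℝ
    upper = limit + halves
    upper≃limit : upper ≃ limit
    upper≃limit = ≃-trans upper (limit + 0ℝ) limit
      (+-cong limit limit halves 0ℝ (≃-pointwise limit limit λ _ → ≡.refl) halves≃0)
      (≃-pointwise (limit + 0ℝ) limit λ n → ℚₚ.+-identityʳ (lo n))

2ℚ : ℚ
2ℚ = + 2 ℚ./ 1

-- Predicate and starting point are those of `√2`, so `√2-Root.limit` is `√2` itself. The fourth
-- root is bisected directly, since `c` must be rational.
module √2-Root = Root (λ q → q ℚ.* q) 2ℚ 1ℚ (ℚₚ.≤ᵇ⇒≤ _) (ℚₚ.≤ᵇ⇒≤ _)
module ⁴√2-Root = Root (λ q → q ℚ.* q ℚ.* (q ℚ.* q)) 2ℚ 1ℚ (ℚₚ.≤ᵇ⇒≤ _) (ℚₚ.≤ᵇ⇒≤ _)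

√2²≃2 : √2 * √2 ≃ fromℕ 2
√2²≃2 = √2-Root.f[limit]≃c (λ x → x * x) (λ _ _ → ≡.refl) (λ x y x≃y → *-cong x y x y x≃y x≃y)

√2≤2 : √2 ≤ fromℕ 2
√2≤2 = ≤-pointwise √2 (fromℕ 2) λ n → ℚₚ.<⇒≤ (proj₂ (√2-Root.lo-within {0} {n} ℕ.z≤n))

-- Opaque, as are τ, κ and the vectors on j i below: otherwise conversion checking
-- evaluates these closed reals, or compares Cauchy proofs.
opaque
  ⁴√2 : ℝ
  ⁴√2 = ⁴√2-Root.limit

  ⁴√2⁴≃2 : ⁴√2 * ⁴√2 * (⁴√2 * ⁴√2) ≃ fromℕ 2
  ⁴√2⁴≃2 = ⁴√2-Root.f[limit]≃c (λ x → x * x * (x * x)) (λ _ _ → ≡.refl) λ x y x≃y →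
    *-cong (x * x) (y * y) (x * x) (y * y) (*-cong x y x y x≃y x≃y) (*-cong x y x y x≃y x≃y)

√2+⁴√2²-pos : Pos (√2 + ⁴√2 * ⁴√2)
√2+⁴√2²-pos = 1ℚ , 0<1 , always λ n →
  ℚₚ.+-mono-≤ (proj₁ (√2-Root.lo-within {0} {n} ℕ.z≤n)) (0≤q*q (seq ⁴√2 n))

-- The two sides come from separate bisections. Both square to 2, and their sum is positive, hence
-- invertible.
√2≃⁴√2² : √2 ≃ ⁴√2 * ⁴√2
√2≃⁴√2² = positive-root-unique {√2} {⁴√2 * ⁴√2} {recip (√2 + ⁴√2 * ⁴√2) √2+⁴√2²-pos}
  (x*recip[x]≃1 (√2 + ⁴√2 * ⁴√2) √2+⁴√2²-pos)
  (≃-trans (√2 * √2) (fromℕ 2) (⁴√2 * ⁴√2 * (⁴√2 * ⁴√2)) √2²≃2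
    (≃-sym (⁴√2 * ⁴√2 * (⁴√2 * ⁴√2)) (fromℕ 2) ⁴√2⁴≃2))

opaque
  τ κ : ℝ
  τ = ½# * (2# - ⁴√2 * ⁴√2)
  κ = τ * ⁴√2 * (⁴√2 * ⁴√2)

  τ≃ : τ ≃ ½# * (2# - ⁴√2 * ⁴√2)
  τ≃ = ≃-pointwise τ τ λ _ → ≡.refl

  κ≃ : κ ≃ τ * ⁴√2 * (⁴√2 * ⁴√2)
  κ≃ = ≃-pointwise κ κ λ _ → ≡.refl

3+2√2≃ : 3+2√2 ≃ 3# + 2# * √2
3+2√2≃ = ≃-pointwise 3+2√2 3+2√2 λ _ → ≡.refl

open Constants ⁴√2 √2 τ κ 3+2√2 √2≃⁴√2² √2²≃2 √2≤2 τ≃ κ≃ 3+2√2≃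

-- Load balancing

does-∩ : ∀ {m} (p q : Subset m) e → does (e ∈? p ∩ q) ≡ does (e ∈? p) ∧ does (e ∈? q)
does-∩ p q e with e ∈? p | e ∈? q
... | yes e∈p | yes e∈q = dec-true (e ∈? p ∩ q) (x∈p∩q⁺ (e∈p , e∈q))
... | yes _   | no  e∉q = dec-false (e ∈? p ∩ q) (e∉q ∘ proj₂ ∘ x∈p∩q⁻ p q)
... | no  e∉p | _       = dec-false (e ∈? p ∩ q) (e∉p ∘ proj₁ ∘ x∈p∩q⁻ p q)

module _ (I : Instance) where
  open Instance I

  -- The summand of `load`: `load I x t e` is `prefix (contribution x e) t`.
  contribution : Assignment I → Fin #machines → Vector ℝ #jobs
  contribution x e k = w e k * sum (λ i → if does (e ∈? edge k i) then fromℕ (x k i) else 0ℝ)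

  opaque
    on : ∀ j → Fin (size j) → Vector ℝ #machines
    on j i e = if does (e ∈? edge j i) then w e j else 0ℝ

    on≃ : ∀ j i e → (if does (e ∈? edge j i) then w e j else 0ℝ) ≃ on j i e
    on≃ j i e = ≃-pointwise (on j i e) (on j i e) λ _ → ≡.refl

    0≤on : ∀ j i e → 0ℝ ≤ on j i e
    0≤on j i e = if-0≤ (does (e ∈? edge j i)) (w-nonNeg e j)

  on-² : ∀ j i e → (if does (e ∈? edge j i) then w e j ² else 0ℝ) ≃ on j i e * on j i e
  on-² j i e = if-* {does (e ∈? edge j i)} {does (e ∈? edge j i)}
    {x = w e j} {w e j} {on j i e} {on j i e}
    (≡.sym (∧-idem (does (e ∈? edge j i)))) (on≃ j i e) (on≃ j i e)

  on-∩ : ∀ j i k i′ e → (if does (e ∈? edge j i ∩ edge k i′) then w e j * w e k else 0ℝ)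
                        ≃ on j i e * on k i′ e
  on-∩ j i k i′ e = if-* {does (e ∈? edge j i)} {does (e ∈? edge k i′)}
    {x = w e j} {w e k} {on j i e} {on k i′ e}
    (does-∩ (edge j i) (edge k i′) e) (on≃ j i e) (on≃ k i′ e)

  -- The formula of `Loads.gain` at `on j i`, available before a choice of hyperedges is fixed.
  gainOn : Assignment I → ∀ j → Fin (size j) → ℝ
  gainOn x j i = sum λ e →
    on j i e * on j i e + (load I x (toℕ j) e * on j i e + load I x (toℕ j) e * on j i e)

  increase≃ : ∀ x j i → increase I x j i ≃ gainOn x j i
  increase≃ x j i = increase-expand (load I x (toℕ j))
    (λ e → if does (e ∈? edge j i) then w e j else 0ℝ) (on j i) (on≃ j i)

  -- Provides the hypotheses of `Loads` for a solution that puts each job `j` on `choice j`.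
  module Chosen (x : Assignment I) (choice : ∀ j → Fin (size j))
                (contribution≃on : ∀ e j → contribution x e j ≃ on j (choice j) e) where

    load-zero : ∀ e → load I x 0 e ≃ 0ℝ
    load-zero e = prefix-zero (contribution x e)

    load-suc : ∀ j e → load I x (suc (toℕ j)) e ≃ load I x (toℕ j) e + on j (choice j) e
    load-suc j e = ≃-trans (load I x (suc (toℕ j)) e) (load I x (toℕ j) e + contribution x e j)
      (load I x (toℕ j) e + on j (choice j) e) (prefix-suc (contribution x e) j)
      (+-cong (load I x (toℕ j) e) (load I x (toℕ j) e) (contribution x e j) (on j (choice j) e)
        (≃-pointwise (load I x (toℕ j) e) (load I x (toℕ j) e) λ _ → ≡.refl) (contribution≃on e j))

    load-mono : ∀ (j : Fin #jobs) e → load I x (toℕ j) e ≤ load I x #jobs e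
    load-mono j e = ≤-trans (load I x (toℕ j) e) (sum {#jobs} (contribution x e)) (load I x #jobs e)
      (prefix≤sum {f = contribution x e} 0≤contribution (toℕ j))
      (≃⇒≤ (sum {#jobs} (contribution x e)) (load I x #jobs e)
        (≃-sym (load I x #jobs e) (sum {#jobs} (contribution x e)) (prefix-all (contribution x e))))
      where
      0≤contribution : ∀ k → 0ℝ ≤ contribution x e k
      0≤contribution k = ≤-trans 0ℝ (on k (choice k) e) (contribution x e k) (0≤on k (choice k) e)
        (≃⇒≤ (on k (choice k) e) (contribution x e k)
          (≃-sym (contribution x e k) (on k (choice k) e) (contribution≃on e k)))

  module Greedy (x : Assignment I) (choice : ∀ j → Fin (size j))
    (contribution≃on : ∀ e j → contribution x e j ≃ on j (choice j) e)
    (greedy≤ : ∀ j i → increase I x j (choice j) ≤ increase I x j i) where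

    open Chosen x choice contribution≃on
    open Dual {#machines} {#jobs} (load I x) (λ j → on j (choice j)) load-zero load-suc load-mono
      (λ j → increase I x j (choice j)) (λ j → increase≃ x j (choice j))

    dual-solution : ∃[ d ] SDPFeasible I d × 1/[3+2√2] * cost I x ≤ SDPObjective I d
    dual-solution =
      record
        { y = λ j → τ * increase I x j (choice j)
        ; ν = λ e → κ * load I x #jobs e
        ; v = λ j i e → ⁴√2 * on j i e
        } ,
      ((λ j i → dual-feasible j {λ e → if does (e ∈? edge j i) then w e j ² else 0ℝ} {on j i}
          (0≤on j i) (on-² j i) (≤-trans (increase I x j (choice j)) (increase I x j i) (gainOn x j i)
            (greedy≤ j i) (≃⇒≤ (increase I x j i) (gainOn x j i) (increase≃ x j i)))) ,
       (λ j i k i′ _ → gram≤ {x = ⁴√2} {on j i} {on k i′}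
          {λ e → if does (e ∈? edge j i ∩ edge k i′) then w e j * w e k else 0ℝ}
          r≤2 (0≤on j i) (0≤on k i′) (on-∩ j i k i′))) ,
      objective
      where
      objective : 1/[3+2√2] * cost I x
        ≤ sum (λ j → τ * increase I x j (choice j))
          - fromℚ ½ * sum (λ e → κ * load I x #jobs e * (κ * load I x #jobs e))
      objective = ≃⇒≤ (1/[3+2√2] * cost I x) (sum (λ j → τ * increase I x j (choice j))
          - fromℚ ½ * sum (λ e → κ * load I x #jobs e * (κ * load I x #jobs e)))
        (dual-objective {1/[3+2√2]} (x*recip[x]≃1 3+2√2 3+2√2-pos))

    ratio : ∀ x′ (choice′ : ∀ j → Fin (size j)) →
            (∀ e j → contribution x′ e j ≃ on j (choice′ j) e) → cost I x ≤ 3+2√2 * cost I x′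
    ratio x′ choice′ contribution′≃on = Competitor.competitive {#machines} {#jobs}
      (load I x) (λ j → on j (choice j)) load-zero load-suc load-mono
      (load I x′) (λ j → on j (choice′ j)) C′.load-zero C′.load-suc C′.load-mono
      (λ j → 0≤on j (choice′ j))
      -- Greedy's inequality between increases, carried over to gains along `increase≃` on both
      -- sides.
      (λ j → ≤-trans (gainOn x j (choice j)) (increase I x j (choice j)) (gainOn x j (choice′ j))
        (≃⇒≤ (gainOn x j (choice j)) (increase I x j (choice j))
          (≃-sym (increase I x j (choice j)) (gainOn x j (choice j)) (increase≃ x j (choice j))))
        (≤-trans (increase I x j (choice j)) (increase I x j (choice′ j)) (gainOn x j (choice′ j))
          (greedy≤ j (choice′ j))
          (≃⇒≤ (increase I x j (choice′ j)) (gainOn x j (choice′ j)) (increase≃ x j (choice′ j)))))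
      where module C′ = Chosen x′ choice′ contribution′≃on

  -- A solution seen as a choice function: `x j (choice j) ≡ 1` gives access to the greedy
  -- condition, the second part determines the loads.
  ChoiceOf : Assignment I → Set
  ChoiceOf x = Σ (∀ j → Fin (size j)) λ choice →
    (∀ j → x j (choice j) ≡ 1) × (∀ e j → contribution x e j ≃ on j (choice j) e)

  choose : ∀ x → IsSolution I x → ChoiceOf x
  choose x (x∈01 , Σx≡1) = (λ j → proj₁ (pick j)) , (λ j → proj₁ (proj₂ (pick j))) , λ e j →
    ≃-trans (contribution x e j) (if does (e ∈? edge j (proj₁ (pick j))) then w e j else 0ℝ)
      (on j (proj₁ (pick j)) e)
      (proj₂ (proj₂ (pick j)) (λ i → does (e ∈? edge j i)) (w e j))
      (on≃ j (proj₁ (pick j)) e)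
    where
    pick : ∀ j → ∃[ i ] x j i ≡ 1 × (∀ (p : Fin (size j) → Bool) y →
             y * sum (λ i → if p i then fromℕ (x j i) else 0ℝ) ≃ (if p i then y else 0ℝ))
    pick j = one-hot-select (x j) (x∈01 j) (Σx≡1 j)

  conclude : ∀ x → (∀ j i → x j i ≡ 1 → ∀ i′ → increase I x j i ≤ increase I x j i′) → ChoiceOf x →
    (∃[ d ] SDPFeasible I d × 1/[3+2√2] * cost I x ≤ SDPObjective I d)
    × (∀ x′ → ChoiceOf x′ → cost I x ≤ 3+2√2 * cost I x′)
  conclude x greedy (choice , chosen , contribution≃on) =
    dual-solution , λ x′ (choice′ , _ , contribution′≃on) → ratio x′ choice′ contribution′≃on
    where open Greedy x choice contribution≃on (λ j → greedy j (choice j) (chosen j))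

theorem3p3 : (I : Instance) (x : Assignment I) → IsGreedy I x →
    (∃[ d ] SDPFeasible I d × 1/[3+2√2] * cost I x ≤ SDPObjective I d)
    × (∀ OPT → IsOPT I OPT → cost I x ≤ 3+2√2 * OPT)
    × (∀ x′ → IsSolution I x′ → cost I x ≤ 3+2√2 * cost I x′)
theorem3p3 I x (sol , greedy) =
  proj₁ conclusion ,
  -- `x′` attains the optimum, and the bound against it is transported along `cost≃OPT`.
  (λ OPT ((x′ , sol′ , cost≃OPT) , _) → ≤-trans (cost I x) (3+2√2 * cost I x′) (3+2√2 * OPT)
    (ratio x′ sol′)
    (≃⇒≤ (3+2√2 * cost I x′) (3+2√2 * OPT) (*-congˡ 3+2√2 (cost I x′) OPT cost≃OPT))) ,
  ratio
  where
  conclusion : (∃[ d ] SDPFeasible I d × 1/[3+2√2] * cost I x ≤ SDPObjective I d)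
               × (∀ x′ → ChoiceOf I x′ → cost I x ≤ 3+2√2 * cost I x′)
  conclusion = conclude I x greedy (choose I x sol)
  ratio : ∀ x′ → IsSolution I x′ → cost I x ≤ 3+2√2 * cost I x′
  ratio x′ sol′ = proj₂ conclusion x′ (choose I x′ sol′)
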